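{- Let $a$ be a complex number. The elliptic curve $$E:\ y^2-axy-y=x^3-x$$ defines (by the construction $E\mapsto g$ given in the context) a pseudo-involution $(g(x),xg(x))$ in the Riordan group whose $B$-sequence has generating function $$B(x)=\frac{2-a+(1-3a+a^2)x}{1+(1-a)x}.$$
   Context: All power series are formal, with complex coefficients. Riordan arrays: for $g(x)=1+g_1x+\cdots$ and $f(x)=f_1x+f_2x^2+\cdots$ with $f_1\neq 0$, the Riordan array $(g(x),f(x))$ is the infinite lower triangular matrix with entries $t_{n,k}=[x^n]\,g(x)f(x)^k$, $n,k\ge 0$. It acts on power series by $(g(x),f(x))\cdot h(x)=g(x)h(f(x))$. The product of Riordan arrays is $(g,f)\cdot(u,v)=(g(x)u(f(x)),v(f(x)))$, and the identity is $(1,x)$; with this product Riordan arrays form the Riordan group. A Bell array is a Riordan array of the form $(g(x),xg(x))$ with $g(0)=1$. It is a (Bell) pseudo-involution if $(g(x),-xg(x))^2=(1,x)$. $B$-sequence: the $B$-sequence of a Bell pseudo-involution $(g(x),xg(x))$ with entries $t_{n,k}$ is the sequence $b_0,b_1,b_2,\ldots$ such that, for all $n,k\ge 0$, $$t_{n+1,k}=t_{n,k-1}+\sum_{j\ge 0} b_j\, t_{n-j,k+j},$$ where $t_{n,-1}=0$ and $t_{m,l}=0$ whenever $m<0$ or $l>m$. Its generating function is $B(x)=\sum_{j\ge0} b_jx^j$. Construction of $g$ from $E$: (1) Let $y(x)=\frac{1+ax-\sqrt{1+2(a-2)x+a^2x^2+4x^3}}{2}=x+(1-a)x^2+\cdots$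 be the power series solution of $y^2-axy-y=x^3-x$ with $y(0)=0$. (2) Let $s(x)=\frac{y(x)-x}{x^2}$. (3) Let $h(x)=\frac{1}{1-x-x^2s(x)}$. (4) Let $r(x)$ be the compositional inverse of the power series $xh(x)$, and let $v(x)=r(x)/x$. (5) Let $f(x)=\frac{1}{1-x^2v(x)}$. (6) Let $$g(x)=\left(\frac{1}{1+(a-1)x},\ \frac{ -x}{1+(a-1)x}\right)\cdot\frac{f(x)(1+(a-1)x)-1}{x f(x)(ax+a-1)},$$ where the dot denotes the action of a Riordan array on a power series. -}

module Defs where

open import Algebra.Bundles using (CommutativeRing)
import Algebra.Properties.CommutativeSemigroup as CommutativeSemigroupProperties
import Algebra.Properties.Ring as RingProperties
open import Algebra.Structures using (IsCommutativeRing)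
open import Data.Fin.Base using (toℕ)
open import Data.Nat.Base as ℕ using (ℕ; zero; suc; _∸_)
import Data.Nat.Properties as ℕ
open import Data.Product.Base using (∃; _×_; _,_)
open import Data.Rational.Base using (ℚ)
import Data.Rational.Properties as ℚ
open import Level using (0ℓ; _⊔_)
open import Relation.Binary.PropositionalEquality.Core
  using (_≡_; refl; sym; trans; cong; cong₂; subst; subst₂)
open import Relation.Binary.Structures using (IsEquivalence)
open import Relation.Nullary.Negation.Core using (¬_)

module Real where

  open import Data.Rational.Base using (0ℚ; 1ℚ; ½; _+_; _*_; _-_; -_; ∣_∣; _≤_; _<_; Positive; positive; 1/_)

  -- x m - y n → 0 as m and n tend to infinity independently.
  -- Without η, and with the operations below defined by copatterns, terms
  -- built from them are not unfolded down to ℚ during conversion checking.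
  record Close (x y : ℕ → ℚ) : Set where
    no-eta-equality
    field
      close : ∀ ε → 0ℚ < ε → ∃ λ N → ∀ m n → N ℕ.≤ m → N ℕ.≤ n → ∣ x m - y n ∣ < ε

  open Close public

  record ℝ : Set where
    no-eta-equality
    field
      seq    : ℕ → ℚ
      cauchy : Close seq seq

  open ℝ public

  infix 4 _≈ℝ_

  record _≈ℝ_ (x y : ℝ) : Set where
    no-eta-equality
    field
      near : ∀ ε → 0ℚ < ε → ∃ λ N → ∀ n → N ℕ.≤ n → ∣ seq x n - seq y n ∣ < ε

  open _≈ℝ_ public

  module RealLemmas where

    open CommutativeSemigroupProperties (CommutativeRing.+-commutativeSemigroup ℚ.+-*-commutativeRing)
      using (interchange)
    open RingProperties (CommutativeRing.ring ℚ.+-*-commutativeRing)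
      using (-‿involutive; x[y-z]≈xy-xz; [y-z]x≈yx-zx)

    halve : ∀ ε → ½ * ε + ½ * ε ≡ ε
    halve ε = trans (sym (ℚ.*-distribʳ-+ ε ½ ½)) (ℚ.*-identityˡ ε)

    cancel : ∀ p q → (p - q) + q ≡ p
    cancel p q = trans (ℚ.+-assoc p (- q) q)
      (trans (cong (p +_) (ℚ.+-inverseˡ q)) (ℚ.+-identityʳ p))

    telescope : ∀ p q r → (p - q) + (q - r) ≡ p - r
    telescope p q r = trans (sym (ℚ.+-assoc (p - q) q (- r))) (cong (_+ - r) (cancel p q))

    diff-+ : ∀ p q p′ q′ → (p - q) + (p′ - q′) ≡ (p + p′) - (q + q′)
    diff-+ p q p′ q′ = trans (interchange p (- q) p′ (- q′))
      (cong ((p + p′) +_) (sym (ℚ.neg-distrib-+ q q′)))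

    diff-* : ∀ p q p′ q′ → p * (p′ - q′) + (p - q) * q′ ≡ p * p′ - q * q′
    diff-* p q p′ q′ = trans (cong₂ _+_ (x[y-z]≈xy-xz p p′ q′) ([y-z]x≈yx-zx q′ p q))
      (telescope (p * p′) (p * q′) (q * q′))

    ∣p-q∣≡∣q-p∣ : ∀ p q → ∣ p - q ∣ ≡ ∣ q - p ∣
    ∣p-q∣≡∣q-p∣ p q = trans (sym (ℚ.∣-p∣≡∣p∣ (p - q))) (cong ∣_∣
      (trans (ℚ.neg-distrib-+ p (- q))
        (trans (cong (- p +_) (-‿involutive q)) (ℚ.+-comm (- p) q))))

    ½-pos : ∀ {ε} → 0ℚ < ε → 0ℚ < ½ * ε
    ½-pos {ε} 0<ε = subst (_< ½ * ε) (ℚ.*-zeroʳ ½) (ℚ.*-monoʳ-<-pos ½ 0<ε)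

    ∣p+q∣<ε : ∀ p q {ε} → ∣ p ∣ < ½ * ε → ∣ q ∣ < ½ * ε → ∣ p + q ∣ < ε
    ∣p+q∣<ε p q {ε} p< q< = subst (∣ p + q ∣ <_) (halve ε)
      (ℚ.≤-<-trans (ℚ.∣p+q∣≤∣p∣+∣q∣ p q) (ℚ.+-mono-< p< q<))

    ∣p*q∣<Bδ : ∀ p q {B δ} → ∣ p ∣ < B → ∣ q ∣ < δ → ∣ p * q ∣ < B * δ
    ∣p*q∣<Bδ p q {B} {δ} p<B q<δ = subst (_< B * δ) (sym (ℚ.∣p*q∣≡∣p∣*∣q∣ p q))
      (ℚ.≤-<-trans
        (ℚ.*-monoˡ-≤-nonNeg ∣ p ∣ {{ℚ.∣-∣-nonNeg p}} (ℚ.<⇒≤ q<δ))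
        (ℚ.*-monoˡ-<-pos δ {{positive (ℚ.≤-<-trans (ℚ.0≤∣p∣ q) q<δ)}} p<B))

    shrink : ∀ {B ε} → 0ℚ < B → 0ℚ < ε → ∃ λ δ → 0ℚ < δ × B * δ ≡ ε
    shrink {B} {ε} 0<B 0<ε = B⁻¹ * ε , pos , eq
      where
      instance
        B-pos : Positive B
        B-pos = positive 0<B
      B⁻¹ = (1/ B) {{ℚ.pos⇒nonZero B}}
      pos : 0ℚ < B⁻¹ * ε
      pos = subst (_< B⁻¹ * ε) (ℚ.*-zeroʳ B⁻¹) (ℚ.*-monoʳ-<-pos B⁻¹ {{ℚ.1/pos⇒pos B}} 0<ε)
      eq : B * (B⁻¹ * ε) ≡ ε
      eq = trans (sym (ℚ.*-assoc B B⁻¹ ε))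
        (trans (cong (_* ε) (ℚ.*-inverseʳ B {{ℚ.pos⇒nonZero B}})) (ℚ.*-identityˡ ε))

    upˡ : ∀ {M N n} → M ℕ.⊔ N ℕ.≤ n → M ℕ.≤ n
    upˡ {M} {N} = ℕ.m⊔n≤o⇒m≤o M N

    upʳ : ∀ {M N n} → M ℕ.⊔ N ℕ.≤ n → N ℕ.≤ n
    upʳ {M} {N} = ℕ.m⊔n≤o⇒n≤o M N

    close-const : ∀ q → Close (λ _ → q) (λ _ → q)
    close-const q .close ε 0<ε = 0 , λ _ _ _ _ → subst (_< ε) (cong ∣_∣ (sym (ℚ.+-inverseʳ q))) 0<ε

    close-+ : ∀ {x y x′ y′} → Close x y → Close x′ y′ →
              Close (λ n → x n + x′ n) (λ n → y n + y′ n)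
    close-+ {x} {y} {x′} {y′} c c′ .close ε 0<ε
      with close c (½ * ε) (½-pos 0<ε) | close c′ (½ * ε) (½-pos 0<ε)
    ... | M , h | N , h′ = M ℕ.⊔ N , λ m n m≥ n≥ →
      subst (λ z → ∣ z ∣ < ε) (diff-+ (x m) (y n) (x′ m) (y′ n))
        (∣p+q∣<ε (x m - y n) (x′ m - y′ n)
          (h m n (upˡ {M} m≥) (upˡ {M} n≥)) (h′ m n (upʳ {M} m≥) (upʳ {M} n≥)))

    close-neg : ∀ {x y} → Close x y → Close (λ n → - x n) (λ n → - y n)
    close-neg {x} {y} c .close ε 0<ε with close c ε 0<ε
    ... | N , h = N , λ m n m≥ n≥ → subst (_< ε)
      (trans (sym (ℚ.∣-p∣≡∣p∣ (x m - y n))) (cong ∣_∣ (ℚ.neg-distrib-+ (x m) (- y n))))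
      (h m n m≥ n≥)

    bounded : ∀ {x} → Close x x → ∃ λ B → 0ℚ < B × ∃ λ N → ∀ n → N ℕ.≤ n → ∣ x n ∣ < B
    bounded {x} c with close c 1ℚ (ℚ.positive⁻¹ 1ℚ)
    ... | N , h = 1ℚ + ∣ x N ∣ , ℚ.+-mono-<-≤ (ℚ.positive⁻¹ 1ℚ) (ℚ.0≤∣p∣ (x N)) , N ,
      λ n n≥ → ℚ.≤-<-trans
        (subst (λ z → ∣ z ∣ ≤ ∣ x n - x N ∣ + ∣ x N ∣) (cancel (x n) (x N))
          (ℚ.∣p+q∣≤∣p∣+∣q∣ (x n - x N) (x N)))
        (ℚ.+-monoˡ-< ∣ x N ∣ (h n N n≥ ℕ.≤-refl))

    close-* : ∀ {x y x′ y′} → Close x x → Close y′ y′ → Close x y → Close x′ y′ →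
              Close (λ n → x n * x′ n) (λ n → y n * y′ n)
    close-* {x} {y} {x′} {y′} cx cy′ c c′ .close ε 0<ε
      with bounded cx | bounded cy′
    ... | A , 0<A , K , hA | B , 0<B , L , hB
      with shrink 0<A (½-pos 0<ε) | shrink 0<B (½-pos 0<ε)
    ... | α , 0<α , Aα | β , 0<β , Bβ
      with close c β 0<β | close c′ α 0<α
    ... | M , h | N , h′ = (K ℕ.⊔ L) ℕ.⊔ (M ℕ.⊔ N) , λ m n m≥ n≥ →
      subst (λ z → ∣ z ∣ < ε) (diff-* (x m) (y n) (x′ m) (y′ n))
        (∣p+q∣<ε (x m * (x′ m - y′ n)) ((x m - y n) * y′ n)
          (subst (∣ x m * (x′ m - y′ n) ∣ <_) Aα
            (∣p*q∣<Bδ (x m) (x′ m - y′ n) (hA m (upˡ {K} (upˡ {K ℕ.⊔ L} m≥)))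
              (h′ m n (upʳ {M} (upʳ {K ℕ.⊔ L} m≥)) (upʳ {M} (upʳ {K ℕ.⊔ L} n≥)))))
          (subst₂ (λ z b → ∣ z ∣ < b) (ℚ.*-comm (y′ n) (x m - y n)) Bβ
            (∣p*q∣<Bδ (y′ n) (x m - y n) (hB n (upʳ {K} (upˡ {K ℕ.⊔ L} n≥)))
              (h m n (upˡ {M} (upʳ {K ℕ.⊔ L} m≥)) (upˡ {M} (upʳ {K ℕ.⊔ L} n≥))))))

    ≡⇒≈ : ∀ {x y} → (∀ n → seq x n ≡ seq y n) → x ≈ℝ y
    ≡⇒≈ {x} {y} eq .near ε 0<ε = 0 , λ n _ → subst (λ z → ∣ seq x n - z ∣ < ε) (eq n)
      (subst (λ z → ∣ z ∣ < ε) (sym (ℚ.+-inverseʳ (seq x n))) 0<ε)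

    ≈-sym : ∀ {x y} → x ≈ℝ y → y ≈ℝ x
    ≈-sym {x} {y} e .near ε 0<ε with near e ε 0<ε
    ... | N , h = N , λ n n≥ → subst (_< ε) (∣p-q∣≡∣q-p∣ (seq x n) (seq y n)) (h n n≥)

    ≈-trans : ∀ {x y z} → x ≈ℝ y → y ≈ℝ z → x ≈ℝ z
    ≈-trans {x} {y} {z} e e′ .near ε 0<ε
      with near e (½ * ε) (½-pos 0<ε) | near e′ (½ * ε) (½-pos 0<ε)
    ... | M , h | N , h′ = M ℕ.⊔ N , λ n n≥ →
      subst (λ w → ∣ w ∣ < ε) (telescope (seq x n) (seq y n) (seq z n))
        (∣p+q∣<ε (seq x n - seq y n) (seq y n - seq z n) (h n (upˡ {M} n≥)) (h′ n (upʳ {M} n≥)))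

    ≈⇒close : ∀ {x y} → x ≈ℝ y → Close (seq x) (seq y)
    ≈⇒close {x} {y} e .close ε 0<ε
      with close (cauchy x) (½ * ε) (½-pos 0<ε) | near e (½ * ε) (½-pos 0<ε)
    ... | M , h | N , h′ = M ℕ.⊔ N , λ m n m≥ n≥ →
      subst (λ w → ∣ w ∣ < ε) (telescope (seq x m) (seq x n) (seq y n))
        (∣p+q∣<ε (seq x m - seq x n) (seq x n - seq y n)
          (h m n (upˡ {M} m≥) (upˡ {M} n≥)) (h′ n (upʳ {M} n≥)))

    close⇒≈ : ∀ {x y} → Close (seq x) (seq y) → x ≈ℝ y
    close⇒≈ c .near ε 0<ε with close c ε 0<ε
    ... | N , h = N , λ n n≥ → h n n n≥ n≥

  open RealLemmas using (close-const; close-+; close-neg; close-*)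

  infixl 6 _+ℝ_
  infixl 7 _*ℝ_
  infix  8 -ℝ_

  ratℝ : ℚ → ℝ
  ratℝ q .seq _  = q
  ratℝ q .cauchy = close-const q

  0ℝ 1ℝ : ℝ
  0ℝ = ratℝ 0ℚ
  1ℝ = ratℝ 1ℚ

  _+ℝ_ _*ℝ_ : ℝ → ℝ → ℝ
  (x +ℝ y) .seq n  = seq x n + seq y n
  (x +ℝ y) .cauchy = close-+ (cauchy x) (cauchy y)
  (x *ℝ y) .seq n  = seq x n * seq y n
  (x *ℝ y) .cauchy = close-* (cauchy x) (cauchy y) (cauchy x) (cauchy y)

  -ℝ_ : ℝ → ℝ
  (-ℝ x) .seq n  = - seq x n
  (-ℝ x) .cauchy = close-neg (cauchy x)

  ℝ-isCommutativeRing : IsCommutativeRing _≈ℝ_ _+ℝ_ _*ℝ_ -ℝ_ 0ℝ 1ℝ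
  ℝ-isCommutativeRing = record
    { isRing = record
      { +-isAbelianGroup = record
        { isGroup = record
          { isMonoid = record
            { isSemigroup = record
              { isMagma = record
                { isEquivalence = record
                  { refl  = ≡⇒≈ λ _ → refl
                  ; sym   = ≈-sym
                  ; trans = ≈-trans
                  }
                ; ∙-cong = λ x≈y u≈v → close⇒≈ (close-+ (≈⇒close x≈y) (≈⇒close u≈v))
                }
              ; assoc = λ x y z → ≡⇒≈ λ n → ℚ.+-assoc (seq x n) (seq y n) (seq z n)
              }
            ; identity = (λ x → ≡⇒≈ λ n → ℚ.+-identityˡ (seq x n))
                       , (λ x → ≡⇒≈ λ n → ℚ.+-identityʳ (seq x n))
            }
          ; inverse = (λ x → ≡⇒≈ λ n → ℚ.+-inverseˡ (seq x n))
                    , (λ x → ≡⇒≈ λ n → ℚ.+-inverseʳ (seq x n))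
          ; ⁻¹-cong = λ x≈y → close⇒≈ (close-neg (≈⇒close x≈y))
          }
        ; comm = λ x y → ≡⇒≈ λ n → ℚ.+-comm (seq x n) (seq y n)
        }
      ; *-cong = λ {x} {y} {u} {v} x≈y u≈v →
          close⇒≈ (close-* (cauchy x) (cauchy v) (≈⇒close x≈y) (≈⇒close u≈v))
      ; *-assoc = λ x y z → ≡⇒≈ λ n → ℚ.*-assoc (seq x n) (seq y n) (seq z n)
      ; *-identity = (λ x → ≡⇒≈ λ n → ℚ.*-identityˡ (seq x n))
                   , (λ x → ≡⇒≈ λ n → ℚ.*-identityʳ (seq x n))
      ; distrib = (λ x y z → ≡⇒≈ λ n → ℚ.*-distribˡ-+ (seq x n) (seq y n) (seq z n))
                , (λ x y z → ≡⇒≈ λ n → ℚ.*-distribʳ-+ (seq x n) (seq y n) (seq z n))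
      }
    ; *-comm = λ x y → ≡⇒≈ λ n → ℚ.*-comm (seq x n) (seq y n)
    }
    where open RealLemmas using (≡⇒≈; ≈-sym; ≈-trans; ≈⇒close; close⇒≈)

  ℝ-commutativeRing : CommutativeRing 0ℓ 0ℓ
  ℝ-commutativeRing = record { isCommutativeRing = ℝ-isCommutativeRing }

open Real public

record ℂ : Set where
  no-eta-equality
  field
    re im : ℝ

open ℂ public

infix 4 _≈ℂ_

record _≈ℂ_ (z w : ℂ) : Set where
  no-eta-equality
  constructor mk≈ℂ
  field
    re≈ : re z ≈ℝ re w
    im≈ : im z ≈ℝ im w

open _≈ℂ_ public

infixl 6 _+ℂ_ _-ℂ_
infixl 7 _*ℂ_
infix  8 -ℂ_

0ℂ 1ℂ : ℂ
0ℂ .re = 0ℝ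
0ℂ .im = 0ℝ
1ℂ .re = 1ℝ
1ℂ .im = 0ℝ

_+ℂ_ _*ℂ_ : ℂ → ℂ → ℂ
(z +ℂ w) .re = re z +ℝ re w
(z +ℂ w) .im = im z +ℝ im w
(z *ℂ w) .re = re z *ℝ re w +ℝ -ℝ (im z *ℝ im w)
(z *ℂ w) .im = re z *ℝ im w +ℝ im z *ℝ re w

-ℂ_ : ℂ → ℂ
(-ℂ z) .re = -ℝ re z
(-ℂ z) .im = -ℝ im z

_-ℂ_ : ℂ → ℂ → ℂ
z -ℂ w = z +ℂ -ℂ w

2ℂ 3ℂ : ℂ
2ℂ = 1ℂ +ℂ 1ℂ
3ℂ = 2ℂ +ℂ 1ℂ

module ComplexLemmas {c ℓ} (R : CommutativeRing c ℓ) where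

  open CommutativeRing R
    renaming (_+_ to _⊞_; _*_ to _⊠_; -_ to ⊟_; refl to ≈-refl; sym to ≈-sym; trans to ≈-trans)
    hiding (_-_)
  open RingProperties ring using (-1*x≈-x)
  open import Algebra.Solver.Ring.NaturalCoefficients.Default commutativeSemiring
    using (solve; _:=_; _:+_; _:*_)
  open import Relation.Binary.Reasoning.Setoid setoid

  infixl 6 _⊖_

  _⊖_ : Carrier → Carrier → Carrier
  x ⊖ y = x ⊞ ⊟ y

  ⊖≈ : ∀ x y → x ⊖ y ≈ x ⊞ ⊟ 1# ⊠ y
  ⊖≈ x y = +-congˡ (≈-sym (-1*x≈-x y))

  *-re-assoc : ∀ a b a′ b′ a″ b″ →
    (a ⊠ a′ ⊖ b ⊠ b′) ⊠ a″ ⊖ (a ⊠ b′ ⊞ b ⊠ a′) ⊠ b″ ≈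
    a ⊠ (a′ ⊠ a″ ⊖ b′ ⊠ b″) ⊖ b ⊠ (a′ ⊠ b″ ⊞ b′ ⊠ a″)
  *-re-assoc a b a′ b′ a″ b″ = begin
    (a ⊠ a′ ⊖ b ⊠ b′) ⊠ a″ ⊖ (a ⊠ b′ ⊞ b ⊠ a′) ⊠ b″
      ≈⟨ ≈-trans (⊖≈ _ _) (+-congʳ (*-congʳ (⊖≈ _ _))) ⟩
    (a ⊠ a′ ⊞ ⊟ 1# ⊠ (b ⊠ b′)) ⊠ a″ ⊞ ⊟ 1# ⊠ ((a ⊠ b′ ⊞ b ⊠ a′) ⊠ b″)
      ≈⟨ solve 7 (λ u a b a′ b′ a″ b″ →
           (a :* a′ :+ u :* (b :* b′)) :* a″ :+ u :* ((a :* b′ :+ b :* a′) :* b″) :=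
           a :* (a′ :* a″ :+ u :* (b′ :* b″)) :+ u :* (b :* (a′ :* b″ :+ b′ :* a″)))
           ≈-refl (⊟ 1#) a b a′ b′ a″ b″ ⟩
    a ⊠ (a′ ⊠ a″ ⊞ ⊟ 1# ⊠ (b′ ⊠ b″)) ⊞ ⊟ 1# ⊠ (b ⊠ (a′ ⊠ b″ ⊞ b′ ⊠ a″))
      ≈⟨ ≈-trans (⊖≈ _ _) (+-congʳ (*-congˡ (⊖≈ _ _))) ⟨
    a ⊠ (a′ ⊠ a″ ⊖ b′ ⊠ b″) ⊖ b ⊠ (a′ ⊠ b″ ⊞ b′ ⊠ a″) ∎

  *-im-assoc : ∀ a b a′ b′ a″ b″ →
    (a ⊠ a′ ⊖ b ⊠ b′) ⊠ b″ ⊞ (a ⊠ b′ ⊞ b ⊠ a′) ⊠ a″ ≈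
    a ⊠ (a′ ⊠ b″ ⊞ b′ ⊠ a″) ⊞ b ⊠ (a′ ⊠ a″ ⊖ b′ ⊠ b″)
  *-im-assoc a b a′ b′ a″ b″ = begin
    (a ⊠ a′ ⊖ b ⊠ b′) ⊠ b″ ⊞ (a ⊠ b′ ⊞ b ⊠ a′) ⊠ a″
      ≈⟨ +-congʳ (*-congʳ (⊖≈ _ _)) ⟩
    (a ⊠ a′ ⊞ ⊟ 1# ⊠ (b ⊠ b′)) ⊠ b″ ⊞ (a ⊠ b′ ⊞ b ⊠ a′) ⊠ a″
      ≈⟨ solve 7 (λ u a b a′ b′ a″ b″ →
           (a :* a′ :+ u :* (b :* b′)) :* b″ :+ (a :* b′ :+ b :* a′) :* a″ :=
           a :* (a′ :* b″ :+ b′ :* a″) :+ b :* (a′ :* a″ :+ u :* (b′ :* b″)))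
           ≈-refl (⊟ 1#) a b a′ b′ a″ b″ ⟩
    a ⊠ (a′ ⊠ b″ ⊞ b′ ⊠ a″) ⊞ b ⊠ (a′ ⊠ a″ ⊞ ⊟ 1# ⊠ (b′ ⊠ b″))
      ≈⟨ +-congˡ (*-congˡ (⊖≈ _ _)) ⟨
    a ⊠ (a′ ⊠ b″ ⊞ b′ ⊠ a″) ⊞ b ⊠ (a′ ⊠ a″ ⊖ b′ ⊠ b″) ∎

  *-re-identityʳ : ∀ a b → a ⊠ 1# ⊖ b ⊠ 0# ≈ a
  *-re-identityʳ a b = begin
    a ⊠ 1# ⊖ b ⊠ 0#          ≈⟨ ⊖≈ _ _ ⟩
    a ⊠ 1# ⊞ ⊟ 1# ⊠ (b ⊠ 0#) ≈⟨ +-cong (*-identityʳ a) (≈-trans (*-congˡ (zeroʳ b)) (zeroʳ _)) ⟩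
    a ⊞ 0#                   ≈⟨ +-identityʳ a ⟩
    a                        ∎

  *-im-identityʳ : ∀ a b → a ⊠ 0# ⊞ b ⊠ 1# ≈ b
  *-im-identityʳ a b = ≈-trans (+-cong (zeroʳ a) (*-identityʳ b)) (+-identityˡ b)

  *-re-distribˡ : ∀ a b a′ b′ a″ b″ →
    a ⊠ (a′ ⊞ a″) ⊖ b ⊠ (b′ ⊞ b″) ≈ (a ⊠ a′ ⊖ b ⊠ b′) ⊞ (a ⊠ a″ ⊖ b ⊠ b″)
  *-re-distribˡ a b a′ b′ a″ b″ = begin
    a ⊠ (a′ ⊞ a″) ⊖ b ⊠ (b′ ⊞ b″)
      ≈⟨ ⊖≈ _ _ ⟩
    a ⊠ (a′ ⊞ a″) ⊞ ⊟ 1# ⊠ (b ⊠ (b′ ⊞ b″))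
      ≈⟨ solve 7 (λ u a b a′ b′ a″ b″ →
           a :* (a′ :+ a″) :+ u :* (b :* (b′ :+ b″)) :=
           (a :* a′ :+ u :* (b :* b′)) :+ (a :* a″ :+ u :* (b :* b″)))
           ≈-refl (⊟ 1#) a b a′ b′ a″ b″ ⟩
    (a ⊠ a′ ⊞ ⊟ 1# ⊠ (b ⊠ b′)) ⊞ (a ⊠ a″ ⊞ ⊟ 1# ⊠ (b ⊠ b″))
      ≈⟨ +-cong (⊖≈ _ _) (⊖≈ _ _) ⟨
    (a ⊠ a′ ⊖ b ⊠ b′) ⊞ (a ⊠ a″ ⊖ b ⊠ b″) ∎

  *-im-distribˡ : ∀ a b a′ b′ a″ b″ →
    a ⊠ (b′ ⊞ b″) ⊞ b ⊠ (a′ ⊞ a″) ≈ (a ⊠ b′ ⊞ b ⊠ a′) ⊞ (a ⊠ b″ ⊞ b ⊠ a″)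
  *-im-distribˡ = solve 6 (λ a b a′ b′ a″ b″ →
    a :* (b′ :+ b″) :+ b :* (a′ :+ a″) := (a :* b′ :+ b :* a′) :+ (a :* b″ :+ b :* a″)) ≈-refl

  *-re-comm : ∀ a b a′ b′ → a ⊠ a′ ⊖ b ⊠ b′ ≈ a′ ⊠ a ⊖ b′ ⊠ b
  *-re-comm a b a′ b′ = +-cong (*-comm a a′) (-‿cong (*-comm b b′))

  *-im-comm : ∀ a b a′ b′ → a ⊠ b′ ⊞ b ⊠ a′ ≈ a′ ⊠ b ⊞ b′ ⊠ a
  *-im-comm a b a′ b′ = ≈-trans (+-comm _ _) (+-cong (*-comm b a′) (*-comm a b′))

ℂ-isCommutativeRing : IsCommutativeRing _≈ℂ_ _+ℂ_ _*ℂ_ -ℂ_ 0ℂ 1ℂ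
ℂ-isCommutativeRing = record
  { isRing = record
    { +-isAbelianGroup = record
      { isGroup = record
        { isMonoid = record
          { isSemigroup = record
            { isMagma = record
              { isEquivalence = ≈-equiv
              ; ∙-cong = λ p q → mk≈ℂ (R.+-cong (re≈ p) (re≈ q)) (R.+-cong (im≈ p) (im≈ q))
              }
            ; assoc = λ x y z → mk≈ℂ (R.+-assoc _ _ _) (R.+-assoc _ _ _)
            }
          ; identity = (λ x → mk≈ℂ (R.+-identityˡ _) (R.+-identityˡ _))
                     , (λ x → mk≈ℂ (R.+-identityʳ _) (R.+-identityʳ _))
          }
        ; inverse = (λ x → mk≈ℂ (R.-‿inverseˡ _) (R.-‿inverseˡ _))
                  , (λ x → mk≈ℂ (R.-‿inverseʳ _) (R.-‿inverseʳ _))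
        ; ⁻¹-cong = λ p → mk≈ℂ (R.-‿cong (re≈ p)) (R.-‿cong (im≈ p))
        }
      ; comm = λ x y → mk≈ℂ (R.+-comm _ _) (R.+-comm _ _)
      }
    ; *-cong = λ p q → mk≈ℂ
        (R.+-cong (R.*-cong (re≈ p) (re≈ q)) (R.-‿cong (R.*-cong (im≈ p) (im≈ q))))
        (R.+-cong (R.*-cong (re≈ p) (im≈ q)) (R.*-cong (im≈ p) (re≈ q)))
    ; *-assoc = λ x y z → mk≈ℂ
        (*-re-assoc (re x) (im x) (re y) (im y) (re z) (im z))
        (*-im-assoc (re x) (im x) (re y) (im y) (re z) (im z))
    ; *-identity = (λ x → ≈-equiv .IsEquivalence.trans (comm 1ℂ x) (identityʳ x)) , identityʳ
    ; distrib = distribˡ , λ x y z → ≈-equiv .IsEquivalence.trans (comm (y +ℂ z) x)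
        (≈-equiv .IsEquivalence.trans (distribˡ x y z)
          (mk≈ℂ (R.+-cong (re≈ (comm x y)) (re≈ (comm x z)))
                (R.+-cong (im≈ (comm x y)) (im≈ (comm x z)))))
    }
  ; *-comm = comm
  }
  where
  module R = CommutativeRing ℝ-commutativeRing
  open ComplexLemmas ℝ-commutativeRing

  ≈-equiv : IsEquivalence _≈ℂ_
  ≈-equiv = record
    { refl  = mk≈ℂ R.refl R.refl
    ; sym   = λ p → mk≈ℂ (R.sym (re≈ p)) (R.sym (im≈ p))
    ; trans = λ p q → mk≈ℂ (R.trans (re≈ p) (re≈ q)) (R.trans (im≈ p) (im≈ q))
    }

  comm : ∀ x y → x *ℂ y ≈ℂ y *ℂ x
  comm x y = mk≈ℂ (*-re-comm (re x) (im x) (re y) (im y)) (*-im-comm (re x) (im x) (re y) (im y))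

  identityʳ : ∀ x → x *ℂ 1ℂ ≈ℂ x
  identityʳ x = mk≈ℂ (*-re-identityʳ (re x) (im x)) (*-im-identityʳ (re x) (im x))

  distribˡ : ∀ x y z → x *ℂ (y +ℂ z) ≈ℂ x *ℂ y +ℂ x *ℂ z
  distribˡ x y z = mk≈ℂ
    (*-re-distribˡ (re x) (im x) (re y) (im y) (re z) (im z))
    (*-im-distribˡ (re x) (im x) (re y) (im y) (re z) (im z))

ℂ-commutativeRing : CommutativeRing 0ℓ 0ℓ
ℂ-commutativeRing = record { isCommutativeRing = ℂ-isCommutativeRing }

module PowerSeries {c ℓ} (R : CommutativeRing c ℓ) where

  open CommutativeRing R hiding (refl; sym; trans)
  open import Algebra.Properties.Monoid.Sum +-monoid using (sum⁺-syntax)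

  infix  4 _≋_ _≐_/_
  infixl 6 _⊕_ _⊖_
  infixl 7 _⊗_ _·_
  infix  8 ⊝_
  infixr 9 _^_

  Series : Set c
  Series = ℕ → Carrier

  _≋_ : Series → Series → Set ℓ
  p ≋ q = ∀ n → p n ≈ q n

  const : Carrier → Series
  const c zero    = c
  const c (suc n) = 0#

  1ₛ : Series
  1ₛ = const 1#

  X : Series
  X zero          = 0#
  X (suc zero)    = 1#
  X (suc (suc n)) = 0#

  _⊕_ _⊖_ _⊗_ : Series → Series → Series
  (p ⊕ q) n = p n + q n
  (p ⊖ q) n = p n - q n
  (p ⊗ q) n = ∑[ i ≤ n ] (p (toℕ i) * q (n ∸ toℕ i))

  ⊝_ : Series → Series
  (⊝ p) n = - p n

  _·_ : Carrier → Series → Series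
  (c · p) n = c * p n

  _^_ : Series → ℕ → Series
  p ^ zero  = 1ₛ
  p ^ suc k = p ⊗ p ^ k

  -- p(q(x)), meaningful only when q 0 ≈ 0#: then [xⁿ] qᵏ vanishes for
  -- k > n, so that the sum over k may stop at n.
  _∘ₛ_ : Series → Series → Series
  (p ∘ₛ q) n = ∑[ k ≤ n ] (p (toℕ k) * (q ^ toℕ k) n)

  -- r = p / q as an equation in the ring of power series; q need not
  -- have an invertible constant term.
  _≐_/_ : Series → Series → Series → Set ℓ
  r ≐ p / q = r ⊗ q ≋ p

  record _IsInverseOf_ (r p : Series) : Set ℓ where
    field
      constant : r 0 ≈ 0#
      right    : p ∘ₛ r ≋ X
      left     : r ∘ₛ p ≋ X

  -- The conditions making a pair a Riordan array are kept separate, in IsRiordan.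
  record Array : Set c where
    constructor ⟨_,_⟩
    field
      fst snd : Series

  open Array public

  record IsRiordan (A : Array) : Set ℓ where
    field
      fst₀ : fst A 0 ≈ 1#
      snd₀ : snd A 0 ≈ 0#
      snd₁ : ¬ snd A 1 ≈ 0#

  infix 4 _≋ᴬ_

  _≋ᴬ_ : Array → Array → Set ℓ
  ⟨ g , f ⟩ ≋ᴬ ⟨ u , v ⟩ = (g ≋ u) × (f ≋ v)

  entry : Array → ℕ → ℕ → Carrier
  entry ⟨ g , f ⟩ n k = (g ⊗ f ^ k) n

  infixr 7 _▷_ _∙_

  _▷_ : Array → Series → Series
  ⟨ g , f ⟩ ▷ h = g ⊗ (h ∘ₛ f)

  _∙_ : Array → Array → Array
  ⟨ g , f ⟩ ∙ ⟨ u , v ⟩ = ⟨ g ⊗ (u ∘ₛ f) , v ∘ₛ f ⟩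

  ι : Array
  ι = ⟨ 1ₛ , X ⟩

  bell : Series → Array
  bell g = ⟨ g , X ⊗ g ⟩

  record IsPseudoInvolution (g : Series) : Set ℓ where
    field
      isRiordan  : IsRiordan (bell g)
      involutive : ⟨ g , ⊝ (X ⊗ g) ⟩ ∙ ⟨ g , ⊝ (X ⊗ g) ⟩ ≋ᴬ ι

  -- tₙ,ₖ₋₁, with tₙ,₋₁ = 0
  entryLeft : Array → ℕ → ℕ → Carrier
  entryLeft A n zero    = 0#
  entryLeft A n (suc k) = entry A n k

  -- Terms with j > n have a negative row index, hence are 0.
  IsBSequence : Series → Series → Set ℓ
  IsBSequence g b = ∀ n k →
    t (suc n) k ≈ entryLeft (bell g) n k + ∑[ j ≤ n ] (b (toℕ j) * t (n ∸ toℕ j) (k ℕ.+ toℕ j))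
    where t = entry (bell g)

  E : Carrier → Series → Series → Set ℓ
  E a x y = y ⊗ y ⊖ a · x ⊗ y ⊖ y ≋ x ^ 3 ⊖ x

  record Construction (a : Carrier) (g : Series) : Set (c ⊔ ℓ) where
    field
      y s h r v f : Series
      y-curve : E a X y
      y-zero  : y 0 ≈ 0#
      s-def   : s ≐ y ⊖ X / X ^ 2
      h-def   : h ≐ 1ₛ / 1ₛ ⊖ X ⊖ X ^ 2 ⊗ s
      r-def   : r IsInverseOf (X ⊗ h)
      v-def   : v ≐ r / X
      f-def   : f ≐ 1ₛ / 1ₛ ⊖ X ^ 2 ⊗ v
      d e q   : Series
      d-def   : d ≐ 1ₛ / 1ₛ ⊕ (a - 1#) · X
      e-def   : e ≐ ⊝ X / 1ₛ ⊕ (a - 1#) · X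
      q-def   : q ≐ f ⊗ (1ₛ ⊕ (a - 1#) · X) ⊖ 1ₛ / X ⊗ f ⊗ (a · X ⊕ const (a - 1#))
      g-def   : g ≋ ⟨ d , e ⟩ ▷ q

open PowerSeries ℂ-commutativeRing public

-- Write c = a - 1. The curve equation for y, composed with r, becomes
--   v (1 + a x) = 1 + c x + x³ v²,
-- and q satisfies q (a x + c) = x v + c. Substituting gives a multiple of
-- a x + c, which is cancelled even when a is not known to differ from 1, because
-- a and c are comaximal and ℂ is reduced. The resulting quadratic for q turns
-- under x ↦ -x / (1 + c x) into
--   g = 1 + x ((1 - c - c x) g + x (c + (c² - c - 1) x) g²),
-- which determines g, says that g = 1 + x g B(x² g), and is invariant under
-- x ↦ -x g, g ↦ 1/g. Existence needs no division by a x + c either: q, v and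
-- y/x are constructed as solutions of their own quadratics.
module Submission where

open import Algebra.Bundles using (CommutativeRing)
open import Data.Fin.Base using (toℕ)
open import Data.Nat.Base as ℕ using (ℕ; zero; suc; _∸_)
import Data.Nat.Properties as ℕ
open import Data.Product using (∃; ∃!; _×_; _,_)
open import Level using (_⊔_)
open import Relation.Binary.PropositionalEquality.Core as ≡ using (_≡_)
open import Relation.Nullary.Negation.Core using (¬_)
open import Defs using (module PowerSeries)

-- Equality of complex numbers is not decidable constructively, so no step may branch on `a = 1` or
-- on a coefficient being zero; every division becomes an equation or a cancellation. The algebra is
-- carried out in an arbitrary commutative ring with an element `z` for which `x = z * (n * x)`
-- forces `x = 0`. This one property covers the choice of a branch of a quadratic, the uniqueness of
-- its solution and the division by a factor `1 - z * n`. Each identity is a certificate of ideal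
-- membership: the difference of its sides is an explicit combination of the hypotheses, and ring
-- normalisation with integer coefficients confirms it. In these identities composition of series
-- appears only as a ring homomorphism fixing `a`, which carries a polynomial equation at `x` to the
-- same equation at another point.

-- Polynomial identities with integer coefficients and their transport along homomorphisms.

module IntegerSolver {c ℓ} (R : CommutativeRing c ℓ) where

  open CommutativeRing R
  open import Algebra.Properties.AbelianGroup +-abelianGroup
    using () renaming (⁻¹-∙-comm to -‿+-comm; ⁻¹-involutive to -‿involutive; ε⁻¹≈ε to -0≈0)
  open import Algebra.Properties.Ring ring using (-‿distribˡ-*; -‿distribʳ-*)
  open import Algebra.Properties.Semiring.Mult.TCOptimised semiring
    using (×-homo-+; ×1-homo-*; 1+×) renaming (_×_ to _×′_)
  open import Algebra.Solver.Ring.AlmostCommutativeRing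
    using (_-Raw-AlmostCommutative⟶_; fromCommutativeRing)
  open import Data.Integer.Base as ℤ using (ℤ; +_; -[1+_]; _◃_; sign; ∣_∣)
  import Data.Integer.Properties as ℤ
  open import Data.Maybe.Base using (map)
  open import Data.Sign.Base as Sign using (Sign)
  open import Relation.Nullary.Decidable using (dec⇒maybe)
  open import Relation.Binary.Reasoning.Setoid setoid

  private

    ⟦_⟧ℤ : ℤ → Carrier
    ⟦ + n      ⟧ℤ = n ×′ 1#
    ⟦ -[1+ n ] ⟧ℤ = - (suc n ×′ 1#)

    ≡⇒≈ : ∀ {i j} → i ≡ j → ⟦ i ⟧ℤ ≈ ⟦ j ⟧ℤ
    ≡⇒≈ ≡.refl = refl

    ⊖-homo : ∀ m n → ⟦ m ℤ.⊖ n ⟧ℤ ≈ m ×′ 1# - n ×′ 1#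
    ⊖-homo zero    zero    = sym (-‿inverseʳ 0#)
    ⊖-homo zero    (suc n) = sym (+-identityˡ _)
    ⊖-homo (suc m) zero    = sym (trans (+-congˡ -0≈0) (+-identityʳ _))
    ⊖-homo (suc m) (suc n) = begin
      ⟦ suc m ℤ.⊖ suc n ⟧ℤ              ≈⟨ ≡⇒≈ (ℤ.[1+m]⊖[1+n]≡m⊖n m n) ⟩
      ⟦ m ℤ.⊖ n ⟧ℤ                      ≈⟨ ⊖-homo m n ⟩
      m ×′ 1# - n ×′ 1#                 ≈⟨ +-identityˡ _ ⟨
      0# + (m ×′ 1# - n ×′ 1#)          ≈⟨ +-congʳ (-‿inverseʳ 1#) ⟨
      1# - 1# + (m ×′ 1# - n ×′ 1#)     ≈⟨ interchange 1# (- 1#) (m ×′ 1#) (- (n ×′ 1#)) ⟩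
      1# + m ×′ 1# + (- 1# - n ×′ 1#)   ≈⟨ +-congˡ (-‿+-comm 1# (n ×′ 1#)) ⟩
      1# + m ×′ 1# - (1# + n ×′ 1#)     ≈⟨ +-cong (1+× m 1#) (-‿cong (1+× n 1#)) ⟨
      suc m ×′ 1# - suc n ×′ 1#         ∎
      where
      open import Algebra.Properties.CommutativeSemigroup +-commutativeSemigroup using (interchange)

    +-homo : ∀ i j → ⟦ i ℤ.+ j ⟧ℤ ≈ ⟦ i ⟧ℤ + ⟦ j ⟧ℤ
    +-homo (+ m)    (+ n)    = ×-homo-+ 1# m n
    +-homo (+ m)    -[1+ n ] = ⊖-homo m (suc n)
    +-homo -[1+ m ] (+ n)    = trans (⊖-homo n (suc m)) (+-comm _ _)
    +-homo -[1+ m ] -[1+ n ] = begin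
      - (suc (suc (m ℕ.+ n)) ×′ 1#)   ≡⟨ ≡.cong (λ k → - (suc k ×′ 1#)) (ℕ.+-suc m n) ⟨
      - ((suc m ℕ.+ suc n) ×′ 1#)     ≈⟨ -‿cong (×-homo-+ 1# (suc m) (suc n)) ⟩
      - (suc m ×′ 1# + suc n ×′ 1#)   ≈⟨ -‿+-comm _ _ ⟨
      - (suc m ×′ 1#) - suc n ×′ 1#   ∎

    signed : Sign → Carrier → Carrier
    signed Sign.+ x = x
    signed Sign.- x = - x

    ◃-homo : ∀ s n → ⟦ s ◃ n ⟧ℤ ≈ signed s (n ×′ 1#)
    ◃-homo Sign.+ zero    = refl
    ◃-homo Sign.+ (suc n) = refl
    ◃-homo Sign.- zero    = sym -0≈0
    ◃-homo Sign.- (suc n) = refl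

    signed-cong : ∀ s {x y} → x ≈ y → signed s x ≈ signed s y
    signed-cong Sign.+ eq = eq
    signed-cong Sign.- eq = -‿cong eq

    signed-* : ∀ s t x y → signed (s Sign.* t) (x * y) ≈ signed s x * signed t y
    signed-* Sign.+ Sign.+ x y = refl
    signed-* Sign.+ Sign.- x y = -‿distribʳ-* x y
    signed-* Sign.- Sign.+ x y = -‿distribˡ-* x y
    signed-* Sign.- Sign.- x y = begin
      x * y         ≈⟨ -‿involutive _ ⟨
      - - (x * y)   ≈⟨ -‿cong (-‿distribˡ-* x y) ⟩
      - (- x * y)   ≈⟨ -‿distribʳ-* (- x) y ⟩
      - x * - y     ∎

    ⟦⟧ℤ-signed : ∀ i → ⟦ i ⟧ℤ ≈ signed (sign i) (∣ i ∣ ×′ 1#)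
    ⟦⟧ℤ-signed (+ n)    = refl
    ⟦⟧ℤ-signed -[1+ n ] = refl

    *-homo : ∀ i j → ⟦ i ℤ.* j ⟧ℤ ≈ ⟦ i ⟧ℤ * ⟦ j ⟧ℤ
    *-homo i j = begin
      ⟦ sign i Sign.* sign j ◃ ∣ i ∣ ℕ.* ∣ j ∣ ⟧ℤ
        ≈⟨ ◃-homo (sign i Sign.* sign j) (∣ i ∣ ℕ.* ∣ j ∣) ⟩
      signed (sign i Sign.* sign j) ((∣ i ∣ ℕ.* ∣ j ∣) ×′ 1#)
        ≈⟨ signed-cong (sign i Sign.* sign j) (×1-homo-* ∣ i ∣ ∣ j ∣) ⟩
      signed (sign i Sign.* sign j) (∣ i ∣ ×′ 1# * (∣ j ∣ ×′ 1#))
        ≈⟨ signed-* (sign i) (sign j) _ _ ⟩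
      signed (sign i) (∣ i ∣ ×′ 1#) * signed (sign j) (∣ j ∣ ×′ 1#)
        ≈⟨ *-cong (⟦⟧ℤ-signed i) (⟦⟧ℤ-signed j) ⟨
      ⟦ i ⟧ℤ * ⟦ j ⟧ℤ ∎

    -‿homo : ∀ i → ⟦ ℤ.- i ⟧ℤ ≈ - ⟦ i ⟧ℤ
    -‿homo (+ zero)  = sym -0≈0
    -‿homo (+ suc n) = refl
    -‿homo -[1+ n ]  = sym (-‿involutive _)

    homomorphism : ℤ.+-*-rawRing -Raw-AlmostCommutative⟶ fromCommutativeRing R
    homomorphism = record
      { ⟦_⟧    = ⟦_⟧ℤ
      ; +-homo = +-homo
      ; *-homo = *-homo
      ; -‿homo = -‿homo
      ; 0-homo = refl
      ; 1-homo = refl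
      }

  open import Algebra.Solver.Ring ℤ.+-*-rawRing (fromCommutativeRing R) homomorphism
    (λ i j → map ≡⇒≈ (dec⇒maybe (i ℤ.≟ j))) public

  :1 : ∀ {n} → Polynomial n
  :1 = con (+ 1)

  record IsHomomorphism (φ : Carrier → Carrier) : Set (c ⊔ ℓ) where
    field
      ⟨⟩-cong : ∀ {x y} → x ≈ y → φ x ≈ φ y
      ⟨⟩-+    : ∀ x y → φ (x + y) ≈ φ x + φ y
      ⟨⟩-*    : ∀ x y → φ (x * y) ≈ φ x * φ y
      ⟨⟩--    : ∀ x → φ (- x) ≈ - φ x
      ⟨⟩-0    : φ 0# ≈ 0#
      ⟨⟩-1    : φ 1# ≈ 1#

  id-isHomomorphism : IsHomomorphism (λ x → x)
  id-isHomomorphism = record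
    { ⟨⟩-cong = λ eq → eq ; ⟨⟩-+ = λ _ _ → refl ; ⟨⟩-* = λ _ _ → refl
    ; ⟨⟩-- = λ _ → refl ; ⟨⟩-0 = refl ; ⟨⟩-1 = refl }

  open import Data.Vec.Relation.Binary.Pointwise.Inductive using (Pointwise; []; _∷_; lookup)

  module _ {φ : Carrier → Carrier} (hom : IsHomomorphism φ) where

    open IsHomomorphism hom
    open import Algebra.Properties.Semiring.Exp semiring using (_^_)

    private
      ×-image : ∀ n → φ (n ×′ 1#) ≈ n ×′ 1#
      ×-image zero    = ⟨⟩-0
      ×-image (suc n) = begin
        φ (suc n ×′ 1#)      ≈⟨ ⟨⟩-cong (1+× n 1#) ⟩
        φ (1# + n ×′ 1#)     ≈⟨ ⟨⟩-+ 1# (n ×′ 1#) ⟩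
        φ 1# + φ (n ×′ 1#)   ≈⟨ +-cong ⟨⟩-1 (×-image n) ⟩
        1# + n ×′ 1#         ≈⟨ 1+× n 1# ⟨
        suc n ×′ 1#          ∎

      image : ∀ {n} (p : Polynomial n) {ρ σ} → Pointwise (λ x y → φ x ≈ y) ρ σ →
              φ (⟦ p ⟧ ρ) ≈ ⟦ p ⟧ σ
      image (op [+] p q)    eqs = trans (⟨⟩-+ _ _) (+-cong (image p eqs) (image q eqs))
      image (op [*] p q)    eqs = trans (⟨⟩-* _ _) (*-cong (image p eqs) (image q eqs))
      image (con (+ n))     eqs = ×-image n
      image (con -[1+ n ])  eqs = trans (⟨⟩-- _) (-‿cong (×-image (suc n)))
      image (var i)         eqs = lookup eqs i
      image (p :^ zero)     eqs = ⟨⟩-1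
      image (p :^ suc k)    eqs = trans (⟨⟩-* _ _) (*-cong (image p eqs) (image (p :^ k) eqs))
      image (:- p)          eqs = trans (⟨⟩-- _) (-‿cong (image p eqs))

    -- A homomorphism commutes with evaluating an integer polynomial, so only the images of the
    -- variables have to be supplied. They are given up to equality: with `φ` the identity this is
    -- substitution of equals.
    transport : ∀ {n} (p q : Polynomial n) {ρ σ} → Pointwise (λ x y → φ x ≈ y) ρ σ →
                ⟦ p ⟧ ρ ≈ ⟦ q ⟧ ρ → ⟦ p ⟧ σ ≈ ⟦ q ⟧ σ
    transport p q eqs eq = trans (sym (image p eqs)) (trans (⟨⟩-cong eq) (image q eqs))

  vanish : ∀ k {x y} → x ≈ y → k * (x - y) ≈ 0#
  vanish k {x} {y} eq = trans (*-congˡ (trans (+-congʳ eq) (-‿inverseʳ y))) (zeroʳ k)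

  absorb : ∀ {s k x y} → x ≈ y → s + k * (x - y) ≈ s
  absorb eq = trans (+-congˡ (vanish _ eq)) (+-identityʳ _)

  -- The coefficient `k₁` is the cofactor of the hypothesis. It is read off from the polynomial
  -- identity passed last, which holds without hypotheses and is left to `solve`.
  by₁ : ∀ {l r k₁ x₁ y₁} → x₁ ≈ y₁ → l - r ≈ k₁ * (x₁ - y₁) → l ≈ r
  by₁ h₁ eq = x∙y⁻¹≈ε⇒x≈y _ _ (trans eq (vanish _ h₁))
    where open import Algebra.Properties.AbelianGroup +-abelianGroup using (x∙y⁻¹≈ε⇒x≈y)

  by₂ : ∀ {l r k₁ x₁ y₁ k₂ x₂ y₂} → x₁ ≈ y₁ → x₂ ≈ y₂ →
        l - r ≈ k₁ * (x₁ - y₁) + k₂ * (x₂ - y₂) → l ≈ r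
  by₂ h₁ h₂ eq = by₁ h₁ (trans eq (absorb h₂))

-- In a ring of power series, this holds of the indeterminate.
Separated : ∀ {c ℓ} (R : CommutativeRing c ℓ) → CommutativeRing.Carrier R → Set (c ⊔ ℓ)
Separated R z = ∀ n {x} → x ≈ z * (n * x) → x ≈ 0#
  where open CommutativeRing R

Reduced : ∀ {c ℓ} → CommutativeRing c ℓ → Set (c ⊔ ℓ)
Reduced R = ∀ x → x * x ≈ 0# → x ≈ 0#
  where open CommutativeRing R

Nontrivial : ∀ {c ℓ} → CommutativeRing c ℓ → Set ℓ
Nontrivial R = ¬ 1# ≈ 0#
  where open CommutativeRing R

-- Quadratic equations over a ring with a separated element.

module Algebraic {c ℓ} (R : CommutativeRing c ℓ) (z a : CommutativeRing.Carrier R)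
  (separated : Separated R z) where

  open CommutativeRing R
  open IntegerSolver R
  open import Algebra.Properties.AbelianGroup +-abelianGroup using (x∙y⁻¹≈ε⇒x≈y)
  open import Data.Integer.Base using (0ℤ)
  open import Data.Vec.Base using ([]; _∷_)
  open import Data.Vec.Relation.Binary.Pointwise.Inductive using ([]; _∷_)
  open import Data.Fin.Patterns using (0F; 1F; 2F)

  private

    -- Uniqueness in certificate form: modulo the hypothesis, `p - q` is `z` times a multiple of
    -- itself and hence zero.
    sep₁ : ∀ {n p q k₁ x₁ y₁} → x₁ ≈ y₁ →
           p - q ≈ z * (n * (p - q)) + k₁ * (x₁ - y₁) → p ≈ q
    sep₁ h₁ eq = x∙y⁻¹≈ε⇒x≈y _ _ (separated _ (trans eq (absorb h₁)))

    sep₂ : ∀ {n p q k₁ x₁ y₁ k₂ x₂ y₂} → x₁ ≈ y₁ → x₂ ≈ y₂ →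
           p - q ≈ z * (n * (p - q)) + k₁ * (x₁ - y₁) + k₂ * (x₂ - y₂) → p ≈ q
    sep₂ h₁ h₂ eq = sep₁ h₁ (trans eq (absorb h₂))

    sep₃ : ∀ {n p q k₁ x₁ y₁ k₂ x₂ y₂ k₃ x₃ y₃} → x₁ ≈ y₁ → x₂ ≈ y₂ → x₃ ≈ y₃ →
           p - q ≈ z * (n * (p - q)) + k₁ * (x₁ - y₁) + k₂ * (x₂ - y₂) + k₃ * (x₃ - y₃) → p ≈ q
    sep₃ h₁ h₂ h₃ eq = sep₂ h₁ h₂ (trans eq (absorb h₃))

  rhs : Carrier → Carrier → Carrier → Carrier → Carrier → Carrier
  rhs x A B C w = A + x * (B * w + C * (w * w))

  -- At the indeterminate, each coefficient of the right side involves only earlier coefficients of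
  -- `w`, which gives existence by iteration. The point `x` is kept free so that composition can
  -- move it. With `C = 0` and `A = 1` the equation says that `w` inverts `1 - x * B`.
  Fixed : Carrier → Carrier → Carrier → Carrier → Carrier → Set ℓ
  Fixed x A B C w = w ≈ rhs x A B C w

  -- The equations of y/x, v, q and g.
  Fixed-y Fixed-v Fixed-q Fixed-g : Carrier → Carrier → Set ℓ
  Fixed-y x w = Fixed x (1# - x * x) (- a) 1# w
  Fixed-v x w = Fixed x (1# + (a - 1#) * x) (- a) (x * x) w
  Fixed-q x w = Fixed x (1# + (a - 1#) * x) (- (a + (a - 1# + (a - 1#)) * x))
    (x * (a * x + (a - 1#))) w
  Fixed-g x w = Fixed x 1# (1# - (a - 1#) - (a - 1#) * x)
    (x * ((a - 1#) + ((a - 1#) * (a - 1#) - (a - 1#) - 1#) * x)) w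

  B-equation : Carrier → Carrier → Set ℓ
  B-equation x w = w * (1# + (1# - a) * x) ≈
    (1# + 1# - a) + (1# - (1# + 1# + 1#) * a + a * a) * x

  Curve : Carrier → Carrier → Set ℓ
  Curve x y = y * y - a * x * y - y ≈ x * (x * (x * 1#)) - x

  private

    rhsₚ : ∀ {n} (x A B C w : Polynomial n) → Polynomial n
    rhsₚ x A B C w = A :+ x :* (B :* w :+ C :* (w :* w))

    yₚ vₚ qₚ gₚ curveˡ curveʳ : ∀ {n} (a x w : Polynomial n) → Polynomial n
    yₚ a x w = rhsₚ x (:1 :- x :* x) (:- a) :1 w
    vₚ a x w = rhsₚ x (:1 :+ (a :- :1) :* x) (:- a) (x :* x) w
    qₚ a x w = rhsₚ x (:1 :+ (a :- :1) :* x) (:- (a :+ (a :- :1 :+ (a :- :1)) :* x))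
      (x :* (a :* x :+ (a :- :1))) w
    gₚ a x w = rhsₚ x :1 (:1 :- (a :- :1) :- (a :- :1) :* x)
      (x :* ((a :- :1) :+ ((a :- :1) :* (a :- :1) :- (a :- :1) :- :1) :* x)) w
    curveˡ a x w = w :* w :- a :* x :* w :- w
    curveʳ a x w = x :* (x :* (x :* :1)) :- x

    Bˡ Bʳ : ∀ {n} (a x w : Polynomial n) → Polynomial n
    Bˡ a x w = w :* (:1 :+ (:1 :- a) :* x)
    Bʳ a x w = (:1 :+ :1 :- a) :+ (:1 :- (:1 :+ :1 :+ :1) :* a :+ a :* a) :* x

    Dₚ : ∀ {n} (a z : Polynomial n) → Polynomial n
    Dₚ a z = a :* z :+ (a :- :1)

    transport₃ : ∀ {φ} → IsHomomorphism φ → (p q : ∀ {n} (a x w : Polynomial n) → Polynomial n) →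
      ∀ {x x′ w w′} → φ a ≈ a → φ x ≈ x′ → φ w ≈ w′ →
      ⟦ p {3} (var 0F) (var 1F) (var 2F) ⟧ (a ∷ x ∷ w ∷ []) ≈
      ⟦ q {3} (var 0F) (var 1F) (var 2F) ⟧ (a ∷ x ∷ w ∷ []) →
      ⟦ p {3} (var 0F) (var 1F) (var 2F) ⟧ (a ∷ x′ ∷ w′ ∷ []) ≈
      ⟦ q {3} (var 0F) (var 1F) (var 2F) ⟧ (a ∷ x′ ∷ w′ ∷ [])
    transport₃ hom p q {x} {x′} {w} {w′} φa φx φw =
      transport hom (p (var 0F) (var 1F) (var 2F)) (q (var 0F) (var 1F) (var 2F))
        {a ∷ x ∷ w ∷ []} {a ∷ x′ ∷ w′ ∷ []} (φa ∷ φx ∷ φw ∷ [])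

  module _ {φ : Carrier → Carrier} (hom : IsHomomorphism φ) (φa : φ a ≈ a) where

    φ-Curve : ∀ {x x′ w w′} → φ x ≈ x′ → φ w ≈ w′ → Curve x w → Curve x′ w′
    φ-Curve = transport₃ hom curveˡ curveʳ φa

    φ-y : ∀ {x x′ w w′} → φ x ≈ x′ → φ w ≈ w′ → Fixed-y x w → Fixed-y x′ w′
    φ-y = transport₃ hom (λ a x w → w) yₚ φa

    φ-v : ∀ {x x′ w w′} → φ x ≈ x′ → φ w ≈ w′ → Fixed-v x w → Fixed-v x′ w′
    φ-v = transport₃ hom (λ a x w → w) vₚ φa

    φ-q : ∀ {x x′ w w′} → φ x ≈ x′ → φ w ≈ w′ → Fixed-q x w → Fixed-q x′ w′
    φ-q = transport₃ hom (λ a x w → w) qₚ φa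

    φ-g : ∀ {x x′ w w′} → φ x ≈ x′ → φ w ≈ w′ → Fixed-g x w → Fixed-g x′ w′
    φ-g = transport₃ hom (λ a x w → w) gₚ φa

    φ-inverse : ∀ {x x′ w w′} → φ x ≈ x′ → φ w ≈ w′ → x * (1# - w) ≈ 1# → x′ * (1# - w′) ≈ 1#
    φ-inverse = transport₃ hom (λ a x w → x :* (:1 :- w)) (λ a x w → :1) φa

    φ-B : ∀ {x x′ w w′} → φ x ≈ x′ → φ w ≈ w′ → B-equation x w → B-equation x′ w′
    φ-B = transport₃ hom Bˡ Bʳ φa

  -- The uniqueness of the construction rests on this alone: the intermediate series of two
  -- constructions are never compared.
  g-unique : ∀ {g g′} → Fixed-g z g → Fixed-g z g′ → g ≈ g′
  g-unique {g} {g′} g-eq g′-eq = sep₂ g-eq g′-eq (solve 4 (λ z a g g′ →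
    let c = a :- :1 ; e = c :* c :- c :- :1 in
    g :- g′ :=
    z :* ((:1 :- c :- c :* z :+ z :* (c :+ e :* z) :* (g :+ g′)) :* (g :- g′)) :+
      :1 :* (g :- gₚ a z g) :+ (:- :1) :* (g′ :- gₚ a z g′))
    refl z a g g′)

  g-expansion : ∀ {g} → Fixed-g z g → ∃ λ p → g ≈ 1# + z * p
  g-expansion g-eq = _ , g-eq

  -- The series `s` is defined by `y = z + z² s`, so the denominator of `h` is `1 - y`.
  h-inverse : ∀ {y s h} → s * (z * (z * 1#)) ≈ y - z → h * (1# - z - z * (z * 1#) * s) ≈ 1# →
              h * (1# - y) ≈ 1#
  h-inverse {y} {s} {h} s-eq h-eq = by₂ h-eq s-eq (solve 4 (λ z y s h →
    h :* (:1 :- y) :- :1 :=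
    :1 :* (h :* (:1 :- z :- z :* (z :* :1) :* s) :- :1) :+
      h :* (s :* (z :* (z :* :1)) :- (y :- z)))
    refl z y s h)

  -- `H` and `Y` stand for `h` and `y` composed with `r`. Since `H = z / r` inverts `v`, the
  -- equation `H * (1 - Y) = 1` gives `Y = 1 - v`, and the point `(v * z, 1 - v)` lies on the curve.
  -- The curve equation there is `v` times the equation of `v`; multiplying by `H` removes that
  -- factor.
  v-fixed : (∀ {x y} → x * z ≈ y * z → x ≈ y) → ∀ {r v H Y} →
            H * (1# - Y) ≈ 1# → r * H ≈ z → Curve r Y → v * z ≈ r → Fixed-v z v
  v-fixed cancel-z {r} {v} {H} {Y} H-eq r-eq curve v-eq =
    by₂ vH≈1 curve′ (solve 4 (λ z a v H →
      v :- vₚ a z v :=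
      (:- (v :- vₚ a z v)) :* (v :* H :- :1) :+
        H :* (curveˡ a (v :* z) (:1 :- v) :- curveʳ a (v :* z) (:1 :- v)))
      refl z a v H)
    where
    vH≈1 : v * H ≈ 1#
    vH≈1 = cancel-z (by₂ v-eq r-eq (solve 4 (λ z r v H →
      v :* H :* z :- :1 :* z := H :* (v :* z :- r) :+ :1 :* (r :* H :- z)) refl z r v H))
    Y≈1-v : Y ≈ 1# - v
    Y≈1-v = by₂ H-eq vH≈1 (solve 3 (λ v H Y →
      Y :- (:1 :- v) := (:- v) :* (H :* (:1 :- Y) :- :1) :+ (:1 :- Y) :* (v :* H :- :1))
      refl v H Y)
    curve′ : Curve (v * z) (1# - v)
    curve′ = φ-Curve id-isHomomorphism refl (sym v-eq) Y≈1-v curve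

  -- With `c = a - 1` and `1 = f * (1 - z² v)`, the numerator `f * (1 + c z) - 1` equals
  -- `z * f * (z * v + c)`. Then `f` cancels because it is invertible and `z` by assumption.
  qD≈zv+c : (∀ {x y} → x * z ≈ y * z → x ≈ y) → ∀ {f v q} →
            f * (1# - z * (z * 1#) * v) ≈ 1# →
            q * (z * f * (a * z + (a - 1#))) ≈ f * (1# + (a - 1#) * z) - 1# →
            q * (a * z + (a - 1#)) ≈ z * v + (a - 1#)
  qD≈zv+c cancel-z {f} {v} {q} f-eq q-eq = cancel-z (by₂ q-eq f-eq (solve 5 (λ z a f v q →
    q :* Dₚ a z :* z :- (z :* v :+ (a :- :1)) :* z :=
    (:1 :- z :* z :* v) :* (q :* (z :* f :* Dₚ a z) :- (f :* (:1 :+ (a :- :1) :* z) :- :1)) :+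
      (:1 :- z :* z :* v :- z :* (q :* Dₚ a z :- z :* v :- (a :- :1))) :*
        (f :* (:1 :- z :* (z :* :1) :* v) :- :1))
    refl z a f v q))

  -- Multiply the equation of `v` by `z` and put `z * v = W - c`, where `c = a - 1` and `W = q * D`
  -- for `D = a z + c`. The terms free of `W` collect to `D * (1 + c z)` because `a = c + 1`, so all
  -- terms are multiples of `D`.
  q-fixed : (∀ {x y} → (a * z + (a - 1#)) * x ≈ (a * z + (a - 1#)) * y → x ≈ y) → ∀ {v q} →
            Fixed-v z v → q * (a * z + (a - 1#)) ≈ z * v + (a - 1#) → Fixed-q z q
  q-fixed cancel-D {v} {q} v-eq qD = cancel-D (by₂ v-eq qD (solve 4 (λ z a v q →
    Dₚ a z :* q :- Dₚ a z :* qₚ a z q :=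
    z :* (v :- vₚ a z v) :+
      (:1 :+ a :* z :+ (a :- :1 :+ (a :- :1)) :* z :* z :-
        (q :* Dₚ a z :+ z :* v :+ (a :- :1)) :* z :* z) :*
        (q :* Dₚ a z :- (z :* v :+ (a :- :1))))
    refl z a v q))

  -- The point `- (z * d)` is `x = -z / (1 + c z)` with `c = a - 1`, where `1 + c x = d`. This is
  -- also the origin of `c² - c - 1`: the factor `a x + c` times `1 + c z` is `c + (c² - a) z`, and
  -- `a = c + 1`.
  g-fixed : ∀ {d Q} → d * (1# + (a - 1#) * z) ≈ 1# → Fixed-q (- (z * d)) Q → Fixed-g z (d * Q)
  g-fixed {d} {Q} d-eq Q-eq = by₂ Q-eq d-eq (solve 4 (λ z a d Q →
    d :* Q :- gₚ a z (d :* Q) :=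
    (:1 :+ (a :- :1) :* z) :* (Q :- qₚ a (:- (z :* d)) Q) :+
      (:- (Q :* Q :* z :* z :* z :* d :* d :* a :+
           Q :* ((a :- :1 :+ (a :- :1)) :* z :* z :* d :- (:1 :+ (a :- :1) :* z)) :+ (a :- :1) :* z)) :*
        (d :* (:1 :+ (a :- :1) :* z) :- :1))
    refl z a d Q)

  -- Compares `K` with `1/g` as solutions at `- (z * g)` without forming the inverse: after
  -- multiplication by `g` the difference is `g * K - 1`, which is `z` times a multiple of itself.
  g-involutive : ∀ {g K} → Fixed-g z g → Fixed-g (- (z * g)) K → g * K ≈ 1#
  g-involutive {g} {K} g-eq K-eq = sep₂ K-eq g-eq (solve 4 (λ z a g K →
    let c = a :- :1 ; e = c :* c :- c :- :1 in
    g :* K :- :1 :=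
    z :* (((c :* z :* g :- e :* z :* z :* g :* g) :* (g :* K :+ :1) :- (:1 :- c) :* g :- c :* z :* g :* g) :*
        (g :* K :- :1)) :+
      g :* (K :- gₚ a (:- (z :* g)) K) :+ :1 :* (g :- gₚ a z g))
    refl z a g K)

  -- At `z² g` the denominator of `B` is `1 - (a - 1) z² g`. Multiplied by it, the claim becomes the
  -- quadratic of `g`; separatedness then cancels this factor.
  g-B : ∀ {g β} → Fixed-g z g →
        B-equation (z * (z * g)) β → g ≈ 1# + z * (g * β)
  g-B {g} {β} g-eq β-eq = sep₂ g-eq β-eq (solve 4 (λ z a g β →
    g :- (:1 :+ z :* (g :* β)) :=
    z :* (((a :- :1) :* z :* g) :* (g :- (:1 :+ z :* (g :* β)))) :+ :1 :* (g :- gₚ a z g) :+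
      (:- (z :* g)) :* (Bˡ a (z :* (z :* g)) β :- Bʳ a (z :* (z :* g)) β))
    refl z a g β)

  -- Putting `y = z * u` makes the curve equation `-z` times the equation of `u`, which selects the
  -- branch through the origin.
  curve-solution : ∀ {u} → Fixed-y z u → Curve z (z * u)
  curve-solution {u} u-eq = by₁ u-eq (solve 3 (λ z a u →
    curveˡ a z (z :* u) :- curveʳ a z (z :* u) := (:- z) :* (u :- yₚ a z u)) refl z a u)

  -- The witness comes from `u - 1 = z * (u² - a u - z)`, a rearrangement of the equation of `u`.
  s-solution : ∀ {u} → Fixed-y z u → (u * u - a * u - z) * (z * (z * 1#)) ≈ z * u - z
  s-solution {u} u-eq = by₁ u-eq (solve 3 (λ z a u →
    (u :* u :- a :* u :- z) :* (z :* (z :* :1)) :- (z :* u :- z) := (:- z) :* (u :- yₚ a z u))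
    refl z a u)

  h-solution : ∀ {u s h} → s * (z * (z * 1#)) ≈ z * u - z → Fixed z 1# u 0# h →
               h * (1# - z - z * (z * 1#) * s) ≈ 1#
  h-solution {u} {s} {h} s-eq h-eq = by₂ h-eq s-eq (solve 4 (λ z u s h →
    h :* (:1 :- z :- z :* (z :* :1) :* s) :- :1 :=
    :1 :* (h :- rhsₚ z :1 u (con 0ℤ) h) :+ (:- h) :* (s :* (z :* (z :* :1)) :- (z :* u :- z)))
    refl z u s h)

  right-inverse : ∀ {v U H} → Fixed-v z v → Fixed-y (v * z) U → H * (1# - v * z * U) ≈ 1# →
                  v * z * H ≈ z
  right-inverse {v} {U} {H} v-eq U-eq H-eq = by₂ H-eq rU≈1-v (solve 4 (λ z v U H →
    v :* z :* H :- z :=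
    z :* (H :* (:1 :- v :* z :* U) :- :1) :+ (z :* H) :* (v :* z :* U :- (:1 :- v)))
    refl z v U H)
    where
    -- Both sides are ordinates of curve points over `v * z`, hence roots of one quadratic;
    -- separatedness shows that they are the same root.
    rU≈1-v : v * z * U ≈ 1# - v
    rU≈1-v = sep₂ U-eq v-eq (solve 4 (λ z a v U →
      let δ = v :* z :* U :- (:1 :- v) in
      δ :=
      z :* ((v :* U :- (a :- :1) :- z :* z :* v :* v) :* δ) :+ (v :* z) :* (U :- yₚ a (v :* z) U) :+
        (v :- δ) :* (v :- vₚ a z v))
      refl z a v U)

  -- The expected value of `V` is `1 - y`, the inverse of `h`: the curve at `(z, y)` makes it a
  -- solution of the equation of `v` at `z * h`. The two solutions are compared after multiplication
  -- by `z * h`.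
  left-inverse : ∀ {y h V} → Curve z y → h * (1# - y) ≈ 1# → Fixed-v (z * h) V → V * (z * h) ≈ z
  left-inverse {y} {h} {V} curve h-eq V-eq = sep₃ V-eq curve h-eq (solve 5 (λ z a y h V →
    let p = z :* h in
    V :* p :- z :=
    z :* ((h :* (p :* (V :* p :+ z) :- a)) :* (V :* p :- z)) :+ p :* (V :- vₚ a p V) :+
      (:- (z :* h :* h)) :* (curveˡ a z y :- curveʳ a z y) :+
      (z :* (h :* (:1 :- y) :+ :1 :+ a :* z :* h :- h)) :* (h :* (:1 :- y) :- :1))
    refl z a y h V)

  f-solution : ∀ {v f} → Fixed z 1# (z * v) 0# f → f * (1# - z * (z * 1#) * v) ≈ 1#
  f-solution {v} {f} f-eq = by₁ f-eq (solve 3 (λ z v f →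
    f :* (:1 :- z :* (z :* :1) :* v) :- :1 := :1 :* (f :- rhsₚ z :1 (z :* v) (con 0ℤ) f)) refl z v f)

  q-solution : ∀ {v f q} → Fixed-v z v → f * (1# - z * (z * 1#) * v) ≈ 1# → Fixed-q z q →
               q * (z * f * (a * z + (a - 1#))) ≈ f * (1# + (a - 1#) * z) - 1#
  q-solution {v} {f} {q} v-eq f-eq q-eq = by₂ qD f-eq (solve 5 (λ z a v f q →
    q :* (z :* f :* Dₚ a z) :- (f :* (:1 :+ (a :- :1) :* z) :- :1) :=
    (z :* f) :* (q :* Dₚ a z :- (z :* v :+ (a :- :1))) :+
      (:- :1) :* (f :* (:1 :- z :* (z :* :1) :* v) :- :1))
    refl z a v f q)
    where
    -- `D` times the equation of `q` and `z` times the equation of `v` are the same quadratic, in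
    -- `W` and in `W′`.
    qD : q * (a * z + (a - 1#)) ≈ z * v + (a - 1#)
    qD = sep₂ q-eq v-eq (solve 4 (λ z a v q →
      let W = q :* Dₚ a z ; W′ = z :* v :+ (a :- :1) in
      W :- W′ :=
      z :* ((z :* (W :+ W′) :- (a :+ (a :- :1 :+ (a :- :1)) :* z)) :* (W :- W′)) :+
        Dₚ a z :* (q :- qₚ a z q) :+ (:- z) :* (v :- vₚ a z v))
      refl z a v q)

  inverse-solution : ∀ {k d} → Fixed z 1# (- k) 0# d → d * (1# + k * z) ≈ 1#
  inverse-solution {k} {d} d-eq = by₁ d-eq (solve 3 (λ z k d →
    d :* (:1 :+ k :* z) :- :1 := :1 :* (d :- rhsₚ z :1 (:- k) (con 0ℤ) d)) refl z k d)

  e-solution : ∀ {k d} → d * (1# + k) ≈ 1# → - (z * d) * (1# + k) ≈ - z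
  e-solution {k} {d} d-eq = by₁ d-eq (solve 3 (λ z k d →
    (:- (z :* d)) :* (:1 :+ k) :- (:- z) := (:- z) :* (d :* (:1 :+ k) :- :1))
    refl z k d)

  e-unique : ∀ {k d e} → d * (1# + k) ≈ 1# → e * (1# + k) ≈ - z → e ≈ - (z * d)
  e-unique {k} {d} {e} d-eq e-eq = by₂ d-eq e-eq (solve 4 (λ z k d e →
    e :- :- (z :* d) := (:- e) :* (d :* (:1 :+ k) :- :1) :+ d :* (e :* (:1 :+ k) :- :- z))
    refl z k d e)

  D-expand : ∀ x y → (a * z + (a - 1#)) * (x - y) ≈ a * (z * (x - y)) + (a - 1#) * (x - y)
  D-expand x y = solve 4 (λ z a x y →
    Dₚ a z :* (x :- y) := a :* (z :* (x :- y)) :+ (a :- :1) :* (x :- y)) refl z a x y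

  -- Bridges two notations: the construction uses scalar multiples and constant series, the abstract
  -- ring only products with the element `a`.
  module Presentation {az cz D : Carrier}
    (az≈ : az ≈ a * z) (cz≈ : cz ≈ (a - 1#) * z) (D≈ : D ≈ a * z + (a - 1#)) where

    curve≈ : ∀ y → y * y - az * y - y ≈ y * y - a * z * y - y
    curve≈ y = +-congʳ (+-congˡ (-‿cong (*-congʳ az≈)))

    1+cz≈ : ∀ x → x * (1# + cz) ≈ x * (1# + (a - 1#) * z)
    1+cz≈ x = *-congˡ (+-congˡ cz≈)

    denominator≈ : ∀ q f → q * (z * f * D) ≈ q * (z * f * (a * z + (a - 1#)))
    denominator≈ q f = *-congˡ (*-congˡ D≈)

    numerator≈ : ∀ f → f * (1# + cz) - 1# ≈ f * (1# + (a - 1#) * z) - 1#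
    numerator≈ f = +-congʳ (1+cz≈ f)

module Identities {c ℓ} (R : CommutativeRing c ℓ) where

  open CommutativeRing R
  open IntegerSolver R using (solve; _:=_; _:+_; _:*_; :-_; :1)

  expand : ∀ z w b f t → w * (b + z * f * t) ≈ b * w + z * (w * f * t)
  expand = solve 5 (λ z w b f t → w :* (b :+ z :* f :* t) := b :* w :+ z :* (w :* f :* t)) refl

  shift-column : ∀ z g F → g * (z * g * F) ≈ z * (g * F * g)
  shift-column = solve 3 (λ z g F → g :* (z :* g :* F) := z :* (g :* F :* g)) refl

  split-column : ∀ z g F β → g * F * (1# + z * (g * β)) ≈ g * F + g * (z * g * F) * β
  split-column = solve 4 (λ z g F β →
    g :* F :* (:1 :+ z :* (g :* β)) := g :* F :+ g :* (z :* g :* F) :* β) refl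

  flip-sign : ∀ z g k → - (- (z * g) * k) ≈ z * (g * k)
  flip-sign = solve 3 (λ z g k → :- ((:- (z :* g)) :* k) := z :* (g :* k)) refl

-- The ring of formal power series.

module SeriesRing {c ℓ} (R : CommutativeRing c ℓ) where

  open CommutativeRing R
  open PowerSeries R
  open import Data.Nat.Base using (_≤_; _<_; z≤n; s≤s)
  open import Algebra.Properties.Monoid.Sum +-monoid using (sum; sum⁺-syntax; sum-syntax; sum-cong-≋)
  open import Algebra.Properties.CommutativeSemigroup +-commutativeSemigroup using (interchange)
  open import Relation.Binary.Reasoning.Setoid setoid

  tail : Series → Series
  tail p n = p (suc n)

  0ₛ : Series
  0ₛ n = 0#

  ⊗-cong : ∀ {p p′ q q′} → p ≋ p′ → q ≋ q′ → p ⊗ q ≋ p′ ⊗ q′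
  ⊗-cong p≋ q≋ n = sum-cong-≋ {suc n} λ i → *-cong (p≋ (toℕ i)) (q≋ (n ∸ toℕ i))

  ⊗-zeroˡ : ∀ {p} → p ≋ 0ₛ → ∀ q → p ⊗ q ≋ 0ₛ
  ⊗-zeroˡ p≋0 q zero    = trans (+-identityʳ _) (trans (*-congʳ (p≋0 0)) (zeroˡ _))
  ⊗-zeroˡ p≋0 q (suc n) = trans
    (+-cong (trans (*-congʳ (p≋0 0)) (zeroˡ _)) (⊗-zeroˡ (λ m → p≋0 (suc m)) q n)) (+-identityʳ 0#)

  const-⊗ : ∀ x p → const x ⊗ p ≋ x · p
  const-⊗ x p zero    = +-identityʳ _
  const-⊗ x p (suc n) = trans (+-congˡ (⊗-zeroˡ {tail (const x)} (λ _ → refl) p n)) (+-identityʳ _)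

  tail-X : tail X ≋ 1ₛ
  tail-X zero    = refl
  tail-X (suc n) = refl

  const-0 : const 0# ≋ 0ₛ
  const-0 zero    = refl
  const-0 (suc n) = refl

  X-⊗-zero : ∀ p → (X ⊗ p) 0 ≈ 0#
  X-⊗-zero p = trans (+-identityʳ _) (zeroˡ _)

  X-⊗-suc : ∀ p n → (X ⊗ p) (suc n) ≈ p n
  X-⊗-suc p n = begin
    0# * p (suc n) + (tail X ⊗ p) n   ≈⟨ +-cong (zeroˡ _) (⊗-cong {tail X} {1ₛ} {p} {p} tail-X (λ _ → refl) n) ⟩
    0# + (1ₛ ⊗ p) n                   ≈⟨ +-identityˡ _ ⟩
    (1ₛ ⊗ p) n                        ≈⟨ const-⊗ 1# p n ⟩
    1# * p n                          ≈⟨ *-identityˡ _ ⟩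
    p n                               ∎

  ⊗-distribˡ : ∀ p q r → p ⊗ (q ⊕ r) ≋ p ⊗ q ⊕ p ⊗ r
  ⊗-distribˡ p q r zero    = begin
    p 0 * (q 0 + r 0) + 0#              ≈⟨ +-identityʳ _ ⟩
    p 0 * (q 0 + r 0)                   ≈⟨ distribˡ _ _ _ ⟩
    p 0 * q 0 + p 0 * r 0               ≈⟨ +-cong (+-identityʳ _) (+-identityʳ _) ⟨
    p 0 * q 0 + 0# + (p 0 * r 0 + 0#)   ∎
  ⊗-distribˡ p q r (suc n) = begin
    p 0 * (q (suc n) + r (suc n)) + (tail p ⊗ (q ⊕ r)) n
      ≈⟨ +-cong (distribˡ _ _ _) (⊗-distribˡ (tail p) q r n) ⟩
    p 0 * q (suc n) + p 0 * r (suc n) + ((tail p ⊗ q) n + (tail p ⊗ r) n)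
      ≈⟨ interchange _ _ _ _ ⟩
    p 0 * q (suc n) + (tail p ⊗ q) n + (p 0 * r (suc n) + (tail p ⊗ r) n) ∎

  -- The Cauchy product unfolds by definition along its left factor; this is the unfolding along the
  -- right one, from which commutativity follows.
  ⊗-tailʳ : ∀ p q n → (p ⊗ q) (suc n) ≈ q 0 * p (suc n) + (p ⊗ tail q) n
  ⊗-tailʳ p q zero    = begin
    p 0 * q 1 + (p 1 * q 0 + 0#)   ≈⟨ +-congˡ (+-identityʳ _) ⟩
    p 0 * q 1 + p 1 * q 0          ≈⟨ +-comm _ _ ⟩
    p 1 * q 0 + p 0 * q 1          ≈⟨ +-cong (*-comm _ _) (sym (+-identityʳ _)) ⟩
    q 0 * p 1 + (p 0 * q 1 + 0#)   ∎
  ⊗-tailʳ p q (suc n) = begin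
    p 0 * q (suc (suc n)) + (tail p ⊗ q) (suc n)
      ≈⟨ +-congˡ (⊗-tailʳ (tail p) q n) ⟩
    p 0 * q (suc (suc n)) + (q 0 * p (suc (suc n)) + (tail p ⊗ tail q) n)
      ≈⟨ x∙yz≈y∙xz _ _ _ ⟩
    q 0 * p (suc (suc n)) + (p 0 * q (suc (suc n)) + (tail p ⊗ tail q) n) ∎
    where
    open import Algebra.Properties.CommutativeSemigroup +-commutativeSemigroup using (x∙yz≈y∙xz)

  ⊗-comm : ∀ p q → p ⊗ q ≋ q ⊗ p
  ⊗-comm p q zero    = +-congʳ (*-comm _ _)
  ⊗-comm p q (suc n) = trans (+-congˡ (⊗-comm (tail p) q n)) (sym (⊗-tailʳ q p n))

  ⊗-identityˡ : ∀ p → 1ₛ ⊗ p ≋ p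
  ⊗-identityˡ p n = trans (const-⊗ 1# p n) (*-identityˡ _)

  ⊗-distribʳ : ∀ p q r → (q ⊕ r) ⊗ p ≋ q ⊗ p ⊕ r ⊗ p
  ⊗-distribʳ p q r n = begin
    ((q ⊕ r) ⊗ p) n         ≈⟨ ⊗-comm (q ⊕ r) p n ⟩
    (p ⊗ (q ⊕ r)) n         ≈⟨ ⊗-distribˡ p q r n ⟩
    (p ⊗ q) n + (p ⊗ r) n   ≈⟨ +-cong (⊗-comm p q n) (⊗-comm p r n) ⟩
    (q ⊗ p) n + (r ⊗ p) n   ∎

  ·-⊗ : ∀ x p q → (x · p) ⊗ q ≋ x · (p ⊗ q)
  ·-⊗ x p q zero    = begin
    x * p 0 * q 0 + 0#     ≈⟨ +-identityʳ _ ⟩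
    x * p 0 * q 0          ≈⟨ *-assoc _ _ _ ⟩
    x * (p 0 * q 0)        ≈⟨ *-congˡ (+-identityʳ _) ⟨
    x * (p 0 * q 0 + 0#)   ∎
  ·-⊗ x p q (suc n) = trans (+-cong (*-assoc _ _ _) (·-⊗ x (tail p) q n)) (sym (distribˡ _ _ _))

  ⊗-assoc : ∀ p q r → (p ⊗ q) ⊗ r ≋ p ⊗ (q ⊗ r)
  ⊗-assoc p q r zero    = begin
    (p 0 * q 0 + 0#) * r 0 + 0#     ≈⟨ +-congʳ (*-congʳ (+-identityʳ _)) ⟩
    p 0 * q 0 * r 0 + 0#            ≈⟨ +-congʳ (*-assoc _ _ _) ⟩
    p 0 * (q 0 * r 0) + 0#          ≈⟨ +-congʳ (*-congˡ (+-identityʳ _)) ⟨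
    p 0 * (q 0 * r 0 + 0#) + 0#     ∎
  ⊗-assoc p q r (suc n) = begin
    (p 0 * q 0 + 0#) * r (suc n) + ((p 0 · tail q ⊕ tail p ⊗ q) ⊗ r) n
      ≈⟨ +-cong (*-congʳ (+-identityʳ _)) (⊗-distribʳ r (p 0 · tail q) (tail p ⊗ q) n) ⟩
    p 0 * q 0 * r (suc n) + (((p 0 · tail q) ⊗ r) n + ((tail p ⊗ q) ⊗ r) n)
      ≈⟨ +-cong (*-assoc _ _ _) (+-cong (·-⊗ (p 0) (tail q) r n) (⊗-assoc (tail p) q r n)) ⟩
    p 0 * (q 0 * r (suc n)) + (p 0 * (tail q ⊗ r) n + (tail p ⊗ (q ⊗ r)) n)
      ≈⟨ +-assoc _ _ _ ⟨
    p 0 * (q 0 * r (suc n)) + p 0 * (tail q ⊗ r) n + (tail p ⊗ (q ⊗ r)) n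
      ≈⟨ +-congʳ (distribˡ _ _ _) ⟨
    p 0 * (q 0 * r (suc n) + (tail q ⊗ r) n) + (tail p ⊗ (q ⊗ r)) n ∎

  seriesRing : CommutativeRing c ℓ
  seriesRing = record
    { Carrier = Series
    ; _≈_ = _≋_
    ; _+_ = _⊕_
    ; _*_ = _⊗_
    ; -_  = ⊝_
    ; 0#  = 0ₛ
    ; 1#  = 1ₛ
    ; isCommutativeRing = record
      { isRing = record
        { +-isAbelianGroup = record
          { isGroup = record
            { isMonoid = record
              { isSemigroup = record
                { isMagma = record
                  { isEquivalence = record
                    { refl  = λ _ → refl
                    ; sym   = λ eq n → sym (eq n)
                    ; trans = λ eq eq′ n → trans (eq n) (eq′ n)
                    }
                  ; ∙-cong = λ eq eq′ n → +-cong (eq n) (eq′ n)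
                  }
                ; assoc = λ p q r n → +-assoc _ _ _
                }
              ; identity = (λ p n → +-identityˡ _) , (λ p n → +-identityʳ _)
              }
            ; inverse = (λ p n → -‿inverseˡ _) , (λ p n → -‿inverseʳ _)
            ; ⁻¹-cong = λ eq n → -‿cong (eq n)
            }
          ; comm = λ p q n → +-comm _ _
          }
        ; *-cong = λ {p} {p′} {q} {q′} → ⊗-cong {p} {p′} {q} {q′}
        ; *-assoc = ⊗-assoc
        ; *-identity = ⊗-identityˡ , λ p n → trans (⊗-comm p 1ₛ n) (⊗-identityˡ p n)
        ; distrib = ⊗-distribˡ , ⊗-distribʳ
        }
      ; *-comm = ⊗-comm
      }
    }

  module S = CommutativeRing seriesRing

  const-- : ∀ x y → const (x - y) ≋ const x ⊖ const y
  const-- x y zero    = refl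
  const-- x y (suc n) = sym (-‿inverseʳ 0#)

  const-+ : ∀ x y → const (x + y) ≋ const x ⊕ const y
  const-+ x y zero    = refl
  const-+ x y (suc n) = sym (+-identityʳ 0#)

  const-* : ∀ x y → const (x * y) ≋ const x ⊗ const y
  const-* x y zero    = sym (+-identityʳ _)
  const-* x y (suc n) = sym (trans (const-⊗ x (const y) (suc n)) (zeroʳ x))

  infix 4 _≋[_]_

  -- Congruence modulo `X ^ n`.
  _≋[_]_ : Series → ℕ → Series → Set ℓ
  p ≋[ n ] q = ∀ m → m < n → p m ≈ q m

  -- Multiplication by `p = X ⊗ tail p` is a contraction: it gains one coefficient of agreement.
  -- This drives every induction on precision below.
  ⊗-agree : ∀ {n q r} p → p 0 ≈ 0# → q ≋[ n ] r → p ⊗ q ≋[ suc n ] p ⊗ r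
  ⊗-agree {n} {q} {r} p p₀ eq m (s≤s m≤n) = begin
    (p ⊗ q) m                      ≈⟨ factor q m ⟩
    (X ⊗ (tail p ⊗ q)) m           ≈⟨ step m m≤n ⟩
    (X ⊗ (tail p ⊗ r)) m           ≈⟨ factor r m ⟨
    (p ⊗ r) m                      ∎
    where
    p≋X⊗tail : p ≋ X ⊗ tail p
    p≋X⊗tail zero    = trans p₀ (sym (X-⊗-zero (tail p)))
    p≋X⊗tail (suc k) = sym (X-⊗-suc (tail p) k)
    factor : ∀ s → p ⊗ s ≋ X ⊗ (tail p ⊗ s)
    factor s = S.trans {p ⊗ s} {X ⊗ tail p ⊗ s} {X ⊗ (tail p ⊗ s)}
      (⊗-cong {p} {X ⊗ tail p} {s} {s} p≋X⊗tail (λ _ → refl)) (⊗-assoc X (tail p) s)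
    agree : ∀ u k → k < n → (u ⊗ q) k ≈ (u ⊗ r) k
    agree u zero    k<n = +-congʳ (*-congˡ (eq 0 k<n))
    agree u (suc k) k<n = +-cong (*-congˡ (eq (suc k) k<n)) (agree (tail u) k (ℕ.<-trans (ℕ.n<1+n k) k<n))
    step : ∀ m → m ≤ n → (X ⊗ (tail p ⊗ q)) m ≈ (X ⊗ (tail p ⊗ r)) m
    step zero    _   = trans (X-⊗-zero (tail p ⊗ q)) (sym (X-⊗-zero (tail p ⊗ r)))
    step (suc m) m<n = trans (X-⊗-suc (tail p ⊗ q) m)
      (trans (agree (tail p) m m<n) (sym (X-⊗-suc (tail p ⊗ r) m)))

  agree⇒≋ : ∀ {p q} → (∀ n → p ≋[ n ] q) → p ≋ q
  agree⇒≋ eq n = eq (suc n) n (ℕ.n<1+n n)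

  ⊗-agree₂ : ∀ {n p q r s} → p ≋[ n ] q → r ≋[ n ] s → p ⊗ r ≋[ n ] q ⊗ s
  ⊗-agree₂ eq eq′ zero    m<n = +-congʳ (*-cong (eq 0 m<n) (eq′ 0 m<n))
  ⊗-agree₂ {suc n} {p} {q} {r} {s} eq eq′ (suc m) (s≤s m<n) = +-cong
    (*-cong (eq 0 (s≤s z≤n)) (eq′ (suc m) (s≤s m<n)))
    (⊗-agree₂ {n} {tail p} {tail q} (λ k k<n → eq (suc k) (s≤s k<n)) (λ k k<n → eq′ k (ℕ.m<n⇒m<1+n k<n)) m m<n)

  X-separated : ∀ n {x} → x ≋ X ⊗ (n ⊗ x) → x ≋ 0ₛ
  X-separated p {x} eq = agree⇒≋ vanish
    where
    vanish : ∀ n → x ≋[ n ] 0ₛ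
    vanish (suc n) m m<1+n = begin
      x m                  ≈⟨ eq m ⟩
      (X ⊗ (p ⊗ x)) m      ≈⟨ S.*-assoc X p x m ⟨
      ((X ⊗ p) ⊗ x) m      ≈⟨ ⊗-agree (X ⊗ p) (X-⊗-zero p) (vanish n) m m<1+n ⟩
      ((X ⊗ p) ⊗ 0ₛ) m     ≈⟨ S.zeroʳ (X ⊗ p) m ⟩
      0#                   ∎

  ⊗X-cancel : ∀ {p q} → p ⊗ X ≋ q ⊗ X → p ≋ q
  ⊗X-cancel {p} {q} eq n = begin
    p n             ≈⟨ X-⊗-suc p n ⟨
    (X ⊗ p) (suc n) ≈⟨ ⊗-comm X p (suc n) ⟩
    (p ⊗ X) (suc n) ≈⟨ eq (suc n) ⟩
    (q ⊗ X) (suc n) ≈⟨ ⊗-comm X q (suc n) ⟨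
    (X ⊗ q) (suc n) ≈⟨ X-⊗-suc q n ⟩
    q n             ∎

  -- Existence of solutions by iterating a contraction.

  module Solution (A B C : Series) where

    Φ : Series → Series
    Φ w = A ⊕ X ⊗ (B ⊗ w ⊕ C ⊗ (w ⊗ w))

    Φ-agree : ∀ {n p q} → p ≋[ n ] q → Φ p ≋[ suc n ] Φ q
    Φ-agree {n} {p} {q} eq m m<1+n = +-congˡ (⊗-agree X refl
      (λ k k<n → +-cong (B-agree k k<n) (C-agree k k<n)) m m<1+n)
      where
      B-agree : B ⊗ p ≋[ n ] B ⊗ q
      B-agree = ⊗-agree₂ {n} {B} {B} (λ _ _ → refl) eq
      C-agree : C ⊗ (p ⊗ p) ≋[ n ] C ⊗ (q ⊗ q)
      C-agree = ⊗-agree₂ {n} {C} {C} (λ _ _ → refl) (⊗-agree₂ {n} {p} {q} eq eq)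

    approx : ℕ → Series
    approx zero    = 0ₛ
    approx (suc n) = Φ (approx n)

    approx-step : ∀ n → approx n ≋[ n ] approx (suc n)
    approx-step (suc n) = Φ-agree (approx-step n)

    solution : Series
    -- Coefficient `n` is final from stage `suc n` on.
    solution n = approx (suc n) n

    approx-stable : ∀ k n → approx n ≋[ n ] approx (k ℕ.+ n)
    approx-stable zero    n m m<n = refl
    approx-stable (suc k) n m m<n = trans (approx-stable k n m m<n)
      (approx-step (k ℕ.+ n) m (ℕ.<-≤-trans m<n (ℕ.m≤n+m n k)))

    solution-approx : ∀ n → solution ≋[ n ] approx n
    solution-approx n m m<n =
      ≡.subst (λ k → approx (suc m) m ≈ approx k m) (ℕ.m∸n+n≡m m<n)
        (approx-stable (n ∸ suc m) (suc m) m (ℕ.n<1+n m))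

    solves : solution ≋ Φ solution
    solves = agree⇒≋ λ where
      zero    m ()
      (suc n) m m<1+n → trans (solution-approx (suc n) m m<1+n)
        (sym (Φ-agree (solution-approx n) m m<1+n))

  solution-exists : ∀ A B C → ∃ λ w → w ≋ A ⊕ X ⊗ (B ⊗ w ⊕ C ⊗ (w ⊗ w))
  solution-exists A B C = solution , solves
    where open Solution A B C

  -- Composition of power series as a ring homomorphism.

  partial : ℕ → Series → Series → Series
  partial N p q n = ∑[ k < N ] (p (toℕ k) * (q ^ toℕ k) n)

  ⊗-sum : ∀ N q (s : ℕ → Series) (t : ℕ → Carrier) n →
          ∑[ k < N ] (t (toℕ k) * (q ⊗ s (toℕ k)) n) ≈ (q ⊗ (λ m → ∑[ k < N ] (t (toℕ k) * s (toℕ k) m))) n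
  ⊗-sum zero    q s t n = sym (S.zeroʳ q n)
  ⊗-sum (suc N) q s t n = begin
    t 0 * (q ⊗ s 0) n + ∑[ k < N ] (t (suc (toℕ k)) * (q ⊗ s (suc (toℕ k))) n)
      ≈⟨ +-cong first (⊗-sum N q (λ k → s (suc k)) (λ k → t (suc k)) n) ⟩
    (q ⊗ (t 0 · s 0)) n + (q ⊗ rest) n
      ≈⟨ ⊗-distribˡ q (t 0 · s 0) rest n ⟨
    (q ⊗ (t 0 · s 0 ⊕ rest)) n ∎
    where
    rest : Series
    rest m = ∑[ k < N ] (t (suc (toℕ k)) * s (suc (toℕ k)) m)
    first : t 0 * (q ⊗ s 0) n ≈ (q ⊗ (t 0 · s 0)) n
    first = begin
      t 0 * (q ⊗ s 0) n        ≈⟨ *-congˡ (⊗-comm q (s 0) n) ⟩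
      t 0 * (s 0 ⊗ q) n        ≈⟨ ·-⊗ (t 0) (s 0) q n ⟨
      ((t 0 · s 0) ⊗ q) n      ≈⟨ ⊗-comm (t 0 · s 0) q n ⟩
      (q ⊗ (t 0 · s 0)) n      ∎

  -- One Horner step. The number of terms must be separate from the coefficient index here, because
  -- the product with `q` mixes coefficients of different index.
  partial-suc : ∀ N p q → partial (suc N) p q ≋ const (p 0) ⊕ q ⊗ partial N (tail p) q
  partial-suc N p q n = +-cong (scale n) (⊗-sum N q (q ^_) (tail p) n)
    where
    scale : ∀ n → p 0 * 1ₛ n ≈ const (p 0) n
    scale zero    = *-identityʳ _
    scale (suc n) = zeroʳ _

  module _ {q : Series} (q₀ : q 0 ≈ 0#) where

    partial-agree : ∀ n {M N} p → n ≤ M → n ≤ N → partial M p q ≋[ n ] partial N p q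
    partial-agree (suc n) {suc M} {suc N} p (s≤s n≤M) (s≤s n≤N) m m<1+n = begin
      partial (suc M) p q m                              ≈⟨ partial-suc M p q m ⟩
      const (p 0) m + (q ⊗ partial M (tail p) q) m
        ≈⟨ +-congˡ (⊗-agree q q₀ (partial-agree n (tail p) n≤M n≤N) m m<1+n) ⟩
      const (p 0) m + (q ⊗ partial N (tail p) q) m       ≈⟨ partial-suc N p q m ⟨
      partial (suc N) p q m                              ∎

    ∘-partial : ∀ n p → p ∘ₛ q ≋[ n ] partial n p q
    ∘-partial n p m m<n = partial-agree (suc m) {suc m} {n} p ℕ.≤-refl m<n m (ℕ.n<1+n m)

    -- Horner's rule without truncation: since `q 0` vanishes, the terms cut off inside the product
    -- do not reach coefficient `n`.
    ∘-tail : ∀ p → p ∘ₛ q ≋ const (p 0) ⊕ q ⊗ (tail p ∘ₛ q)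
    ∘-tail p n = begin
      partial (suc n) p q n                              ≈⟨ partial-suc n p q n ⟩
      const (p 0) n + (q ⊗ partial n (tail p) q) n
        ≈⟨ +-congˡ (⊗-agree q q₀ (λ m m<n → sym (∘-partial n (tail p) m m<n)) n (ℕ.n<1+n n)) ⟩
      const (p 0) n + (q ⊗ (tail p ∘ₛ q)) n              ∎

    ∘-cong : ∀ {p p′} → p ≋ p′ → p ∘ₛ q ≋ p′ ∘ₛ q
    ∘-cong eq n = sum-cong-≋ {suc n} λ k → *-congʳ {x = (q ^ toℕ k) n} (eq (toℕ k))

    ∘-0 : 0ₛ ∘ₛ q ≋ 0ₛ
    ∘-0 = agree⇒≋ go
      where
      go : ∀ n → 0ₛ ∘ₛ q ≋[ n ] 0ₛ
      go (suc n) m m<1+n = begin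
        (0ₛ ∘ₛ q) m                        ≈⟨ ∘-tail 0ₛ m ⟩
        const 0# m + (q ⊗ (0ₛ ∘ₛ q)) m     ≈⟨ +-cong (const-0 m) (⊗-agree q q₀ (go n) m m<1+n) ⟩
        0# + (q ⊗ 0ₛ) m                    ≈⟨ +-identityˡ _ ⟩
        (q ⊗ 0ₛ) m                         ≈⟨ S.zeroʳ q m ⟩
        0#                                 ∎

    ∘-const : ∀ x → const x ∘ₛ q ≋ const x
    ∘-const x n = begin
      (const x ∘ₛ q) n                   ≈⟨ ∘-tail (const x) n ⟩
      const x n + (q ⊗ (0ₛ ∘ₛ q)) n      ≈⟨ +-congˡ (S.*-congˡ {q} ∘-0 n) ⟩
      const x n + (q ⊗ 0ₛ) n             ≈⟨ +-congˡ (S.zeroʳ q n) ⟩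
      const x n + 0#                     ≈⟨ +-identityʳ _ ⟩
      const x n                          ∎

    ∘-X : X ∘ₛ q ≋ q
    ∘-X n = begin
      (X ∘ₛ q) n                            ≈⟨ ∘-tail X n ⟩
      const 0# n + (q ⊗ (tail X ∘ₛ q)) n    ≈⟨ +-cong (const-0 n) (S.*-congˡ {q} tail-X∘q n) ⟩
      0# + (q ⊗ 1ₛ) n                       ≈⟨ +-identityˡ _ ⟩
      (q ⊗ 1ₛ) n                            ≈⟨ S.*-identityʳ q n ⟩
      q n                                   ∎
      where
      tail-X∘q : tail X ∘ₛ q ≋ 1ₛ
      tail-X∘q n = trans (∘-cong tail-X n) (∘-const 1# n)

    ∘-+ : ∀ p p′ → (p ⊕ p′) ∘ₛ q ≋ p ∘ₛ q ⊕ p′ ∘ₛ q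
    ∘-+ p p′ n = go (suc n) (λ k → (q ^ k) n) p p′
      where
      go : ∀ N (s p p′ : ℕ → Carrier) →
           ∑[ k < N ] ((p (toℕ k) + p′ (toℕ k)) * s (toℕ k)) ≈
           ∑[ k < N ] (p (toℕ k) * s (toℕ k)) + ∑[ k < N ] (p′ (toℕ k) * s (toℕ k))
      go zero    s p p′ = sym (+-identityʳ 0#)
      go (suc N) s p p′ = trans
        (+-cong (distribʳ _ _ _) (go N (λ k → s (suc k)) (tail p) (tail p′))) (interchange _ _ _ _)

    ∘-· : ∀ x p → (x · p) ∘ₛ q ≋ x · (p ∘ₛ q)
    ∘-· x p n = go (suc n) (λ k → (q ^ k) n) p
      where
      go : ∀ N (s p : ℕ → Carrier) →
           ∑[ k < N ] ((x * p (toℕ k)) * s (toℕ k)) ≈ x * ∑[ k < N ] (p (toℕ k) * s (toℕ k))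
      go zero    s p = sym (zeroʳ x)
      go (suc N) s p = trans (+-cong (*-assoc _ _ _) (go N (λ k → s (suc k)) (tail p))) (sym (distribˡ _ _ _))

    -- Induction on precision: peeling one coefficient off `p` leaves a product under a factor `q`,
    -- where agreement to one coefficient fewer is enough.
    ∘-⊗ : ∀ p p′ → (p ⊗ p′) ∘ₛ q ≋ p ∘ₛ q ⊗ (p′ ∘ₛ q)
    ∘-⊗ p p′ = agree⇒≋ λ n → go n p p′
      where
      open import Relation.Binary.Reasoning.Setoid S.setoid as ≋-Reasoning using ()
      -- Both sides are p₀p′₀ + q (p₀ (tail p′ ∘ q) + tail p p′ ∘ q).
      right : ∀ p p′ → p ∘ₛ q ⊗ (p′ ∘ₛ q) ≋
              p 0 · const (p′ 0) ⊕ q ⊗ (p 0 · (tail p′ ∘ₛ q) ⊕ tail p ∘ₛ q ⊗ (p′ ∘ₛ q))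
      right p p′ = ≋-Reasoning.begin
        p ∘ₛ q ⊗ (p′ ∘ₛ q)
          ≋-Reasoning.≈⟨ S.*-congʳ {p′ ∘ₛ q} (∘-tail p) ⟩
        (const (p 0) ⊕ q ⊗ (tail p ∘ₛ q)) ⊗ (p′ ∘ₛ q)
          ≋-Reasoning.≈⟨ S.distribʳ (p′ ∘ₛ q) (const (p 0)) (q ⊗ (tail p ∘ₛ q)) ⟩
        const (p 0) ⊗ (p′ ∘ₛ q) ⊕ q ⊗ (tail p ∘ₛ q) ⊗ (p′ ∘ₛ q)
          ≋-Reasoning.≈⟨ (λ n → +-cong (trans (const-⊗ (p 0) (p′ ∘ₛ q) n) (*-congˡ (∘-tail p′ n)))
               (S.*-assoc q (tail p ∘ₛ q) (p′ ∘ₛ q) n)) ⟩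
        p 0 · (const (p′ 0) ⊕ q ⊗ (tail p′ ∘ₛ q)) ⊕ q ⊗ (tail p ∘ₛ q ⊗ (p′ ∘ₛ q))
          ≋-Reasoning.≈⟨ (λ n → trans (+-congʳ (trans (distribˡ _ _ _) (+-congˡ (pull n)))) (+-assoc _ _ _)) ⟩
        p 0 · const (p′ 0) ⊕ (q ⊗ (p 0 · (tail p′ ∘ₛ q)) ⊕ q ⊗ (tail p ∘ₛ q ⊗ (p′ ∘ₛ q)))
          ≋-Reasoning.≈⟨ (λ n → +-congˡ
               (sym (S.distribˡ q (p 0 · (tail p′ ∘ₛ q)) (tail p ∘ₛ q ⊗ (p′ ∘ₛ q)) n))) ⟩
        p 0 · const (p′ 0) ⊕ q ⊗ (p 0 · (tail p′ ∘ₛ q) ⊕ tail p ∘ₛ q ⊗ (p′ ∘ₛ q)) ≋-Reasoning.∎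
        where
        pull : ∀ n → p 0 * (q ⊗ (tail p′ ∘ₛ q)) n ≈ (q ⊗ (p 0 · (tail p′ ∘ₛ q))) n
        pull n = begin
          p 0 * (q ⊗ (tail p′ ∘ₛ q)) n    ≈⟨ *-congˡ (⊗-comm q (tail p′ ∘ₛ q) n) ⟩
          p 0 * (tail p′ ∘ₛ q ⊗ q) n      ≈⟨ ·-⊗ (p 0) (tail p′ ∘ₛ q) q n ⟨
          ((p 0 · (tail p′ ∘ₛ q)) ⊗ q) n  ≈⟨ ⊗-comm (p 0 · (tail p′ ∘ₛ q)) q n ⟩
          (q ⊗ (p 0 · (tail p′ ∘ₛ q))) n  ∎
      go : ∀ n p p′ → (p ⊗ p′) ∘ₛ q ≋[ n ] p ∘ₛ q ⊗ (p′ ∘ₛ q)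
      go (suc n) p p′ m m<1+n = begin
        ((p ⊗ p′) ∘ₛ q) m
          ≈⟨ ∘-tail (p ⊗ p′) m ⟩
        const (p 0 * p′ 0 + 0#) m + (q ⊗ ((p 0 · tail p′ ⊕ tail p ⊗ p′) ∘ₛ q)) m
          ≈⟨ +-cong (head m) (⊗-agree q q₀ inner m m<1+n) ⟩
        p 0 * const (p′ 0) m + (q ⊗ (p 0 · (tail p′ ∘ₛ q) ⊕ tail p ∘ₛ q ⊗ (p′ ∘ₛ q))) m
          ≈⟨ right p p′ m ⟨
        (p ∘ₛ q ⊗ (p′ ∘ₛ q)) m ∎
        where
        head : ∀ m → const (p 0 * p′ 0 + 0#) m ≈ p 0 * const (p′ 0) m
        head zero    = +-identityʳ _
        head (suc m) = sym (zeroʳ _)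
        inner : (p 0 · tail p′ ⊕ tail p ⊗ p′) ∘ₛ q ≋[ n ] p 0 · (tail p′ ∘ₛ q) ⊕ tail p ∘ₛ q ⊗ (p′ ∘ₛ q)
        inner k k<n = trans (∘-+ (p 0 · tail p′) (tail p ⊗ p′) k)
          (+-cong (∘-· (p 0) (tail p′) k) (go n (tail p) p′ k k<n))

    ∘-isHomomorphism : IntegerSolver.IsHomomorphism seriesRing (_∘ₛ q)
    ∘-isHomomorphism = record
      { ⟨⟩-cong = ∘-cong
      ; ⟨⟩-+ = ∘-+
      ; ⟨⟩-* = ∘-⊗
      ; ⟨⟩-- = λ p n → begin
          ((⊝ p) ∘ₛ q) n                   ≈⟨ ∘-cong {⊝ p} {(- 1#) · p} (λ k → sym (-1*x≈-x _)) n ⟩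
          (((- 1#) · p) ∘ₛ q) n            ≈⟨ ∘-· (- 1#) p n ⟩
          - 1# * (p ∘ₛ q) n                ≈⟨ -1*x≈-x _ ⟩
          - (p ∘ₛ q) n                     ∎
      ; ⟨⟩-0 = ∘-0
      ; ⟨⟩-1 = ∘-const 1#
      }
      where open import Algebra.Properties.Ring ring using (-1*x≈-x)

  -- Reading coefficient `n - j` amounts to multiplying by the `j`-th power of `X`, so the sum is
  -- coefficient `n` of `w` times `b` evaluated at `X ⊗ f`.
  sum-⊗-∘ : ∀ w f b n →
            ∑[ j ≤ n ] (b (toℕ j) * (w ⊗ f ^ toℕ j) (n ∸ toℕ j)) ≈ (w ⊗ (b ∘ₛ (X ⊗ f))) n
  sum-⊗-∘ w f b n = trans (go n w b) (sym (split w b n))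
    where
    open Identities seriesRing using (expand)
    u : Series
    u = X ⊗ f
    split : ∀ w b → w ⊗ (b ∘ₛ u) ≋ b 0 · w ⊕ X ⊗ (w ⊗ f ⊗ (tail b ∘ₛ u))
    split w b n = begin
      (w ⊗ (b ∘ₛ u)) n
        ≈⟨ S.*-congˡ {w} (∘-tail {u} (X-⊗-zero f) b) n ⟩
      (w ⊗ (const (b 0) ⊕ X ⊗ f ⊗ (tail b ∘ₛ u))) n
        ≈⟨ expand X w (const (b 0)) f (tail b ∘ₛ u) n ⟩
      (const (b 0) ⊗ w ⊕ X ⊗ (w ⊗ f ⊗ (tail b ∘ₛ u))) n
        ≈⟨ +-congʳ (const-⊗ (b 0) w n) ⟩
      (b 0 · w ⊕ X ⊗ (w ⊗ f ⊗ (tail b ∘ₛ u))) n ∎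
    go : ∀ n w b → ∑[ j ≤ n ] (b (toℕ j) * (w ⊗ f ^ toℕ j) (n ∸ toℕ j)) ≈
         (b 0 · w ⊕ X ⊗ (w ⊗ f ⊗ (tail b ∘ₛ u))) n
    go zero    w b = +-cong (*-congˡ (S.*-identityʳ w 0)) (sym (X-⊗-zero (w ⊗ f ⊗ (tail b ∘ₛ u))))
    go (suc n) w b = +-cong (*-congˡ (S.*-identityʳ w (suc n))) (begin
      ∑[ j ≤ n ] (b (suc (toℕ j)) * (w ⊗ (f ⊗ f ^ toℕ j)) (n ∸ toℕ j))
        ≈⟨ sum-cong-≋ {suc n} (λ j → *-congˡ {x = b (suc (toℕ j))} (sym (⊗-assoc w f (f ^ toℕ j) (n ∸ toℕ j)))) ⟩
      ∑[ j ≤ n ] (b (suc (toℕ j)) * (w ⊗ f ⊗ f ^ toℕ j) (n ∸ toℕ j))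
        ≈⟨ go n (w ⊗ f) (tail b) ⟩
      (tail b 0 · (w ⊗ f) ⊕ X ⊗ (w ⊗ f ⊗ f ⊗ (tail (tail b) ∘ₛ u))) n
        ≈⟨ split (w ⊗ f) (tail b) n ⟨
      (w ⊗ f ⊗ (tail b ∘ₛ u)) n
        ≈⟨ X-⊗-suc (w ⊗ f ⊗ (tail b ∘ₛ u)) n ⟨
      (X ⊗ (w ⊗ f ⊗ (tail b ∘ₛ u))) (suc n) ∎)

-- The construction over a reduced nontrivial ring.

module Elliptic {c ℓ} (R : CommutativeRing c ℓ) (a : CommutativeRing.Carrier R)
  (reduced : Reduced R) (1≉0 : Nontrivial R) where

  open CommutativeRing R
  open PowerSeries R
  open SeriesRing R
  open import Algebra.Properties.Monoid.Sum +-monoid using (sum⁺-syntax)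
  open import Algebra.Properties.AbelianGroup +-abelianGroup
    using (x∙y⁻¹≈ε⇒x≈y) renaming (ε⁻¹≈ε to -0≈0)

  A : Series
  A = const a

  open Algebraic seriesRing X A X-separated

  const-1 : const (a - 1#) ≋ A ⊖ 1ₛ
  const-1 = const-- a 1#

  scale-X : ∀ x → x · X ≋ const x ⊗ X
  scale-X x n = sym (const-⊗ x X n)

  cX : (a - 1#) · X ≋ (A ⊖ 1ₛ) ⊗ X
  cX n = trans (scale-X (a - 1#) n) (⊗-cong {q = X} {X} const-1 (λ _ → refl) n)

  D : Series
  D = a · X ⊕ const (a - 1#)

  open Presentation {a · X} {(a - 1#) · X} {D} (scale-X a) cX
    (λ n → +-cong (scale-X a n) (const-1 n))

  module _ where

    open IntegerSolver R
    open import Data.Integer.Base using (0ℤ)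

    -- p₀² lies in the ideal generated by the first two hypotheses since a and a - 1 are comaximal.
    coprime-annihilator : ∀ n (p : Series) → (a - 1#) * p 0 ≈ 0# →
                          (∀ m → a * p m + (a - 1#) * p (suc m) ≈ 0#) → p n ≈ 0#
    coprime-annihilator n p head step = go n
      where
      p₀ : p 0 ≈ 0#
      p₀ = reduced (p 0) (by₂ (step 0) head (solve 3 (λ a p q →
        p :* p :- con 0ℤ :=
        p :* ((a :* p :+ (a :- :1) :* q) :- con 0ℤ) :+ (:- (p :+ q)) :* ((a :- :1) :* p :- con 0ℤ))
        refl a (p 0) (p 1)))
      go : ∀ n → p n ≈ 0#
      go zero    = p₀
      go (suc n) = coprime-annihilator n (tail p)
        (by₂ (step 0) p₀ (solve 3 (λ a p q →
          (a :- :1) :* q :- con 0ℤ :=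
          :1 :* ((a :* p :+ (a :- :1) :* q) :- con 0ℤ) :+ (:- a) :* (p :- con 0ℤ)) refl a (p 0) (p 1)))
        (λ m → step (suc m))

  -- Comparing coefficients in the product of `a X + (a - 1)` with the difference `δ` gives a
  -- two-term recurrence for `δ`, which is what `coprime-annihilator` treats.
  D-cancel : ∀ {x y} → (A ⊗ X ⊕ (A ⊖ 1ₛ)) ⊗ x ≋ (A ⊗ X ⊕ (A ⊖ 1ₛ)) ⊗ y → x ≋ y
  D-cancel {x} {y} eq n = x∙y⁻¹≈ε⇒x≈y _ _ (coprime-annihilator n δ head step)
    where
    open import Relation.Binary.Reasoning.Setoid setoid
    open import Algebra.Properties.Ring S.ring using (x[y-z]≈xy-xz)
    δ : Series
    δ = x ⊖ y
    coefficient : ∀ n → a * (X ⊗ δ) n + (a - 1#) * δ n ≈ 0#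
    coefficient n = begin
      a * (X ⊗ δ) n + (a - 1#) * δ n
        ≈⟨ +-cong (const-⊗ a (X ⊗ δ) n)
             (trans (⊗-cong {q = δ} {δ} (λ k → sym (const-1 k)) (λ _ → refl) n) (const-⊗ (a - 1#) δ n)) ⟨
      (A ⊗ (X ⊗ δ)) n + ((A ⊖ 1ₛ) ⊗ δ) n
        ≈⟨ D-expand x y n ⟨
      ((A ⊗ X ⊕ (A ⊖ 1ₛ)) ⊗ δ) n
        ≈⟨ x[y-z]≈xy-xz (A ⊗ X ⊕ (A ⊖ 1ₛ)) x y n ⟩
      ((A ⊗ X ⊕ (A ⊖ 1ₛ)) ⊗ x) n - ((A ⊗ X ⊕ (A ⊖ 1ₛ)) ⊗ y) n
        ≈⟨ +-congʳ (eq n) ⟩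
      ((A ⊗ X ⊕ (A ⊖ 1ₛ)) ⊗ y) n - ((A ⊗ X ⊕ (A ⊖ 1ₛ)) ⊗ y) n
        ≈⟨ -‿inverseʳ _ ⟩
      0# ∎
    head : (a - 1#) * δ 0 ≈ 0#
    head = begin
      (a - 1#) * δ 0                     ≈⟨ +-identityˡ _ ⟨
      0# + (a - 1#) * δ 0                ≈⟨ +-congʳ (trans (*-congˡ (X-⊗-zero δ)) (zeroʳ a)) ⟨
      a * (X ⊗ δ) 0 + (a - 1#) * δ 0     ≈⟨ coefficient 0 ⟩
      0#                                 ∎
    step : ∀ m → a * δ m + (a - 1#) * δ (suc m) ≈ 0#
    step m = trans (+-congʳ (*-congˡ (sym (X-⊗-suc δ m)))) (coefficient (suc m))

  -X⊗-zero : ∀ p → (⊝ (X ⊗ p)) 0 ≈ 0#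
  -X⊗-zero p = trans (-‿cong (X-⊗-zero p)) -0≈0

  -- Uniqueness, the involution and the `B`-sequence use nothing else about a construction, so the
  -- auxiliary series are eliminated here once and for all.
  construction⇒g-fixed : ∀ {g} → Construction a g → Fixed-g X g
  construction⇒g-fixed {g} K = φ-g id-isHomomorphism (λ _ → refl) {X} {X} {d ⊗ (q ∘ₛ e)} {g}
    (λ _ → refl) (λ n → sym (g-def n)) (g-fixed {d} {q ∘ₛ e} d-eq Q-eq)
    where
    open Construction K
    open _IsInverseOf_ r-def
    open IntegerSolver seriesRing using (id-isHomomorphism)
    h-eq : h ⊗ (1ₛ ⊖ y) ≋ 1ₛ
    h-eq = h-inverse {y} {s} {h} s-def h-def
    H-eq : h ∘ₛ r ⊗ (1ₛ ⊖ y ∘ₛ r) ≋ 1ₛ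
    H-eq = φ-inverse (∘-isHomomorphism constant) (∘-const constant a) {h} {h ∘ₛ r} {y} {y ∘ₛ r}
      (λ _ → refl) (λ _ → refl) h-eq
    -- The right inverse law, with the composite of `X ⊗ h` split into its factors.
    rH≋X : r ⊗ (h ∘ₛ r) ≋ X
    rH≋X n = trans (sym (trans (∘-⊗ constant X h n) (⊗-cong {q = h ∘ₛ r} {h ∘ₛ r} (∘-X constant) (λ _ → refl) n)))
      (right n)
    curve : Curve r (y ∘ₛ r)
    curve = φ-Curve (∘-isHomomorphism constant) (∘-const constant a) {X} {r} {y} {y ∘ₛ r}
      (∘-X constant) (λ _ → refl) (λ n → trans (sym (curve≈ y n)) (y-curve n))
    v-eq : Fixed-v X v
    v-eq = v-fixed ⊗X-cancel {r} {v} {h ∘ₛ r} {y ∘ₛ r} H-eq rH≋X curve v-def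
    qD : q ⊗ (A ⊗ X ⊕ (A ⊖ 1ₛ)) ≋ X ⊗ v ⊕ (A ⊖ 1ₛ)
    qD = qD≈zv+c ⊗X-cancel {f} {v} {q} f-def
      (λ n → trans (sym (denominator≈ q f n)) (trans (q-def n) (numerator≈ f n)))
    q-eq : Fixed-q X q
    q-eq = q-fixed D-cancel {v} {q} v-eq qD
    e≋ : e ≋ ⊝ (X ⊗ d)
    e≋ = e-unique {(a - 1#) · X} {d} {e} d-def e-def
    e₀ : e 0 ≈ 0#
    e₀ = trans (e≋ 0) (-X⊗-zero d)
    Q-eq : Fixed-q (⊝ (X ⊗ d)) (q ∘ₛ e)
    Q-eq = φ-q (∘-isHomomorphism e₀) (∘-const e₀ a) {X} {⊝ (X ⊗ d)} {q} {q ∘ₛ e}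
      (λ n → trans (∘-X e₀ n) (e≋ n)) (λ _ → refl) q-eq
    d-eq : d ⊗ (1ₛ ⊕ (A ⊖ 1ₛ) ⊗ X) ≋ 1ₛ
    d-eq n = trans (sym (1+cz≈ d n)) (d-def n)

  assemble : ∀ {u v q h f d} → Fixed-y X u → Fixed-v X v → Fixed-q X q →
             Fixed X 1ₛ u 0ₛ h → Fixed X 1ₛ (X ⊗ v) 0ₛ f → Fixed X 1ₛ (⊝ (A ⊖ 1ₛ)) 0ₛ d →
             Construction a (d ⊗ (q ∘ₛ (⊝ (X ⊗ d))))
  assemble {u} {v} {q} {h} {f} {d} u-eq v-eq q-eq h-fixed f-fixed d-fixed = record
    { y = y ; s = s ; h = h ; r = r ; v = v ; f = f
    ; y-curve = λ n → trans (curve≈ y n) (curve n)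
    ; y-zero = X-⊗-zero u
    ; s-def = s-def
    ; h-def = h-def
    ; r-def = record { constant = r₀ ; right = right ; left = left }
    ; v-def = λ _ → refl
    ; f-def = f-def
    ; d = d ; e = ⊝ (X ⊗ d) ; q = q
    ; d-def = d-def
    ; e-def = e-solution {(a - 1#) · X} {d} d-def
    ; q-def = λ n → trans (denominator≈ q f n)
        (trans (q-solution {v} {f} {q} v-eq f-def q-eq n) (sym (numerator≈ f n)))
    ; g-def = λ _ → refl
    }
    where
    y s r : Series
    y = X ⊗ u
    s = u ⊗ u ⊖ A ⊗ u ⊖ X
    r = v ⊗ X
    curve : Curve X y
    curve = curve-solution {u} u-eq
    s-def : s ≐ y ⊖ X / X ^ 2
    s-def = s-solution {u} u-eq
    h-def : h ≐ 1ₛ / 1ₛ ⊖ X ⊖ X ^ 2 ⊗ s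
    h-def = h-solution {u} {s} {h} s-def h-fixed
    h-eq : h ⊗ (1ₛ ⊖ y) ≋ 1ₛ
    h-eq = h-inverse {y} {s} {h} s-def h-def
    f-def : f ≐ 1ₛ / 1ₛ ⊖ X ^ 2 ⊗ v
    f-def = f-solution {v} {f} f-fixed
    d-def : d ≐ 1ₛ / 1ₛ ⊕ (a - 1#) · X
    d-def n = trans (1+cz≈ d n) (inverse-solution {A ⊖ 1ₛ} {d} d-fixed n)
    r₀ : r 0 ≈ 0#
    r₀ = trans (⊗-comm v X 0) (X-⊗-zero v)
    y∘r : y ∘ₛ r ≋ r ⊗ (u ∘ₛ r)
    y∘r n = trans (∘-⊗ r₀ X u n) (⊗-cong {q = u ∘ₛ r} {u ∘ₛ r} (∘-X r₀) (λ _ → refl) n)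
    right : (X ⊗ h) ∘ₛ r ≋ X
    right n = trans (trans (∘-⊗ r₀ X h n) (⊗-cong {q = h ∘ₛ r} {h ∘ₛ r} (∘-X r₀) (λ _ → refl) n))
      (right-inverse {v} {u ∘ₛ r} {h ∘ₛ r} v-eq
        (φ-y (∘-isHomomorphism r₀) (∘-const r₀ a) {X} {r} {u} {u ∘ₛ r} (∘-X r₀) (λ _ → refl) u-eq)
        (φ-inverse (∘-isHomomorphism r₀) (∘-const r₀ a) {h} {h ∘ₛ r} {y} {r ⊗ (u ∘ₛ r)}
          (λ _ → refl) y∘r h-eq) n)
    p₀ : (X ⊗ h) 0 ≈ 0#
    p₀ = X-⊗-zero h
    left : r ∘ₛ (X ⊗ h) ≋ X
    left n = trans (trans (∘-⊗ p₀ v X n) (⊗-cong {v ∘ₛ (X ⊗ h)} {v ∘ₛ (X ⊗ h)} (λ _ → refl) (∘-X p₀) n))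
      (left-inverse {y} {h} {v ∘ₛ (X ⊗ h)} curve h-eq
        (φ-v (∘-isHomomorphism p₀) (∘-const p₀ a) {X} {X ⊗ h} {v} {v ∘ₛ (X ⊗ h)} (∘-X p₀) (λ _ → refl) v-eq) n)

  construction : ∃ (Construction a)
  construction = build
      (solution-exists (1ₛ ⊖ X ⊗ X) (⊝ A) 1ₛ)
      (solution-exists (1ₛ ⊕ (A ⊖ 1ₛ) ⊗ X) (⊝ A) (X ⊗ X))
      (solution-exists (1ₛ ⊕ (A ⊖ 1ₛ) ⊗ X) (⊝ (A ⊕ (A ⊖ 1ₛ ⊕ (A ⊖ 1ₛ)) ⊗ X)) (X ⊗ (A ⊗ X ⊕ (A ⊖ 1ₛ))))
      (solution-exists 1ₛ (⊝ (A ⊖ 1ₛ)) 0ₛ)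
    where
    build : ∃ (Fixed-y X) → ∃ (Fixed-v X) → ∃ (Fixed-q X) → ∃ (Fixed X 1ₛ (⊝ (A ⊖ 1ₛ)) 0ₛ) →
            ∃ (Construction a)
    build (u , u-eq) (v , v-eq) (q , q-eq) (d , d-eq) =
      build′ (solution-exists 1ₛ u 0ₛ) (solution-exists 1ₛ (X ⊗ v) 0ₛ)
      where
      build′ : ∃ (Fixed X 1ₛ u 0ₛ) → ∃ (Fixed X 1ₛ (X ⊗ v) 0ₛ) → ∃ (Construction a)
      build′ (h , h-eq) (f , f-eq) =
        d ⊗ (q ∘ₛ (⊝ (X ⊗ d))) , assemble {u} {v} {q} {h} {f} {d} u-eq v-eq q-eq h-eq f-eq d-eq

  construction-unique : ∃! _≋_ (Construction a)
  construction-unique = unique construction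
    where
    unique : ∃ (Construction a) → ∃! _≋_ (Construction a)
    unique (g , K) = g , K , λ {g′} K′ →
      g-unique {g} {g′} (construction⇒g-fixed K) (construction⇒g-fixed K′)

  module _ {g : Series} (g-eq : Fixed-g X g) where

    private
      φ : Series
      φ = ⊝ (X ⊗ g)
      φ₀ : φ 0 ≈ 0#
      φ₀ = -X⊗-zero g
      g₀ : g 0 ≈ 1#
      g₀ = let p , eq = g-expansion {g} g-eq in
        trans (eq 0) (trans (+-congˡ (X-⊗-zero p)) (+-identityʳ 1#))

    g-inverse : g ⊗ (g ∘ₛ φ) ≋ 1ₛ
    g-inverse = g-involutive {g} {g ∘ₛ φ} g-eq
      (φ-g (∘-isHomomorphism φ₀) (∘-const φ₀ a) {X} {φ} {g} {g ∘ₛ φ} (∘-X φ₀) (λ _ → refl) g-eq)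

    φ-involutive : φ ∘ₛ φ ≋ X
    φ-involutive n = begin
      (φ ∘ₛ φ) n                  ≈⟨ ⟨⟩-- (X ⊗ g) n ⟩
      - ((X ⊗ g) ∘ₛ φ) n          ≈⟨ -‿cong (∘-⊗ φ₀ X g n) ⟩
      - (X ∘ₛ φ ⊗ (g ∘ₛ φ)) n     ≈⟨ -‿cong (⊗-cong {q = g ∘ₛ φ} {g ∘ₛ φ} (∘-X φ₀) (λ _ → refl) n) ⟩
      - (φ ⊗ (g ∘ₛ φ)) n          ≈⟨ flip-sign X g (g ∘ₛ φ) n ⟩
      (X ⊗ (g ⊗ (g ∘ₛ φ))) n      ≈⟨ S.*-congˡ {X} g-inverse n ⟩
      (X ⊗ 1ₛ) n                  ≈⟨ S.*-identityʳ X n ⟩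
      X n                         ∎
      where
      open import Relation.Binary.Reasoning.Setoid setoid
      open IntegerSolver.IsHomomorphism (∘-isHomomorphism {φ} φ₀)
      open Identities seriesRing using (flip-sign)

    pseudoInvolution : IsPseudoInvolution g
    pseudoInvolution = record
      { isRiordan = record
        { fst₀ = g₀
        ; snd₀ = X-⊗-zero g
        ; snd₁ = λ eq → 1≉0 (trans (sym g₀) (trans (sym (X-⊗-suc g 0)) eq))
        }
      ; involutive = g-inverse , φ-involutive
      }

    -- Column `k + 1` in row `n + 1` is coefficient `n` of `g (xg)^k g`. Replacing the last `g` by
    -- `1 + x g β` yields the entry of column `k` in row `n` plus coefficient `n` of
    -- `g (xg)^(k+1) β`. As `β` is `b` at `x (x g)`, `sum-⊗-∘` turns the latter into the sum of the
    -- definition.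
    isBSequence : ∀ {b} → B-equation X b → IsBSequence g b
    isBSequence {b} b-eq n k = trans (go k) (+-congˡ (sym (trans
      (sum-cong-≋ {suc n} (λ j → *-congˡ {x = b (toℕ j)} (reindex k (toℕ j) (n ∸ toℕ j))))
      (sum-⊗-∘ (g ⊗ (X ⊗ g) ^ k) (X ⊗ g) b n))))
      where
      open import Relation.Binary.Reasoning.Setoid setoid
      open import Algebra.Properties.Monoid.Sum +-monoid using (sum-cong-≋)
      open Identities seriesRing using (shift-column; split-column)
      u β : Series
      u = X ⊗ (X ⊗ g)
      β = b ∘ₛ u
      u₀ : u 0 ≈ 0#
      u₀ = X-⊗-zero (X ⊗ g)
      g≋ : g ≋ 1ₛ ⊕ X ⊗ (g ⊗ β)
      g≋ = g-B {g} {β} g-eq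
        (φ-B (∘-isHomomorphism u₀) (∘-const u₀ a) {X} {u} {b} {β} (∘-X u₀) (λ _ → refl) b-eq)
      ^-+ : ∀ k j → (X ⊗ g) ^ (k ℕ.+ j) ≋ (X ⊗ g) ^ k ⊗ (X ⊗ g) ^ j
      ^-+ zero    j m = sym (S.*-identityˡ ((X ⊗ g) ^ j) m)
      ^-+ (suc k) j m = trans (S.*-congˡ {X ⊗ g} (^-+ k j) m)
        (sym (S.*-assoc (X ⊗ g) ((X ⊗ g) ^ k) ((X ⊗ g) ^ j) m))
      reindex : ∀ k j → g ⊗ (X ⊗ g) ^ (k ℕ.+ j) ≋ g ⊗ (X ⊗ g) ^ k ⊗ (X ⊗ g) ^ j
      reindex k j m = trans (S.*-congˡ {g} (^-+ k j) m)
        (sym (S.*-assoc g ((X ⊗ g) ^ k) ((X ⊗ g) ^ j) m))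
      go : ∀ k → entry (bell g) (suc n) k ≈ entryLeft (bell g) n k + (g ⊗ (X ⊗ g) ^ k ⊗ β) n
      go zero = begin
        (g ⊗ 1ₛ) (suc n)                   ≈⟨ S.*-identityʳ g (suc n) ⟩
        g (suc n)                          ≈⟨ g≋ (suc n) ⟩
        0# + (X ⊗ (g ⊗ β)) (suc n)         ≈⟨ +-congˡ (X-⊗-suc (g ⊗ β) n) ⟩
        0# + (g ⊗ β) n                     ≈⟨ +-congˡ (⊗-cong {q = β} {β} (S.*-identityʳ g) (λ _ → refl) n) ⟨
        0# + (g ⊗ 1ₛ ⊗ β) n                ∎
      go (suc k) = begin
        (g ⊗ (X ⊗ g ⊗ F)) (suc n)          ≈⟨ shift-column X g F (suc n) ⟩
        (X ⊗ (g ⊗ F ⊗ g)) (suc n)          ≈⟨ X-⊗-suc (g ⊗ F ⊗ g) n ⟩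
        (g ⊗ F ⊗ g) n                      ≈⟨ S.*-congˡ {g ⊗ F} g≋ n ⟩
        (g ⊗ F ⊗ (1ₛ ⊕ X ⊗ (g ⊗ β))) n     ≈⟨ split-column X g F β n ⟩
        (g ⊗ F) n + (g ⊗ (X ⊗ g ⊗ F) ⊗ β) n ∎
        where
        F : Series
        F = (X ⊗ g) ^ k

  numerator-B : Series
  numerator-B = const (1# + 1# - a) ⊕ (1# - (1# + 1# + 1#) * a + a * a) · X

  B-series : ∃ λ b → B-equation X b × b ≐ numerator-B / 1ₛ ⊕ (1# - a) · X
  -- The linear equation for the inverse of the denominator `1 + (1 - a) x`, whose constant term is
  -- `1`.
  B-series = build (solution-exists 1ₛ (⊝ (1ₛ ⊖ A)) 0ₛ)
    where
    k N : Series
    k = 1ₛ ⊖ A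
    N = (1ₛ ⊕ 1ₛ ⊖ A) ⊕ (1ₛ ⊖ (1ₛ ⊕ 1ₛ ⊕ 1ₛ) ⊗ A ⊕ A ⊗ A) ⊗ X
    denominator : (1# - a) · X ≋ k ⊗ X
    denominator n = trans (scale-X (1# - a) n) (⊗-cong {q = X} {X} (const-- 1# a) (λ _ → refl) n)
    constant : const (1# + 1# - a) ≋ 1ₛ ⊕ 1ₛ ⊖ A
    constant n = trans (const-- (1# + 1#) a n) (+-congʳ (const-+ 1# 1# n))
    triple : const ((1# + 1# + 1#) * a) ≋ (1ₛ ⊕ 1ₛ ⊕ 1ₛ) ⊗ A
    triple n = trans (const-* (1# + 1# + 1#) a n) (⊗-cong {q = A} {A}
      (λ m → trans (const-+ (1# + 1#) 1# m) (+-congʳ (const-+ 1# 1# m))) (λ _ → refl) n)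
    linear : const (1# - (1# + 1# + 1#) * a + a * a) ≋ 1ₛ ⊖ (1ₛ ⊕ 1ₛ ⊕ 1ₛ) ⊗ A ⊕ A ⊗ A
    linear n = trans (const-+ (1# - (1# + 1# + 1#) * a) (a * a) n)
      (+-cong (trans (const-- 1# ((1# + 1# + 1#) * a) n) (+-congˡ (-‿cong (triple n)))) (const-* a a n))
    numerator : numerator-B ≋ N
    numerator n = +-cong (constant n)
      (trans (scale-X _ n) (⊗-cong {q = X} {X} linear (λ _ → refl) n))

    build : ∃ (Fixed X 1ₛ (⊝ k) 0ₛ) → ∃ λ b → B-equation X b × b ≐ numerator-B / 1ₛ ⊕ (1# - a) · X
    build (w , w-eq) = N ⊗ w , b-eq , λ n →
        trans (S.*-congˡ {N ⊗ w} (λ m → +-congˡ {1ₛ m} (denominator m)) n)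
          (trans (b-eq n) (sym (numerator n)))
      where
      b-eq : B-equation X (N ⊗ w)
      b-eq n = trans (S.*-assoc N w (1ₛ ⊕ k ⊗ X) n)
        (trans (S.*-congˡ {N} (inverse-solution {k} {w} w-eq) n) (S.*-identityʳ N n))

  B-function : ∀ {g} → Construction a g →
    IsPseudoInvolution g × (∃ λ b → IsBSequence g b × b ≐ numerator-B / 1ₛ ⊕ (1# - a) · X)
  B-function {g} K = pseudoInvolution g-eq , sequence B-series
    where
    g-eq : Fixed-g X g
    g-eq = construction⇒g-fixed K
    sequence : (∃ λ b → B-equation X b × b ≐ numerator-B / 1ₛ ⊕ (1# - a) · X) →
               ∃ λ b → IsBSequence g b × b ≐ numerator-B / 1ₛ ⊕ (1# - a) · X
    sequence (b , b-eq , b-def) = b , isBSequence g-eq {b} b-eq , b-def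

open import Defs

-- The complex numbers are reduced and nontrivial.

module Reducedness where

  open import Data.Rational.Base using (0ℚ; 1ℚ; ½; _*_; ∣_∣; _≤_; _<_; positive)
  open import Relation.Binary.PropositionalEquality.Core using (refl; sym; trans; subst)
  import Data.Rational.Properties as ℚ
  open import Data.Empty using (⊥-elim)
  open import Relation.Nullary.Decidable using (yes; no)
  module R = CommutativeRing ℝ-commutativeRing

  square-<⁻¹ : ∀ p ε → 0ℚ < ε → ∣ p * p ∣ < ε * ε → ∣ p ∣ < ε
  square-<⁻¹ p ε 0<ε pp<εε with ∣ p ∣ ℚ.<? ε
  ... | yes p<ε = p<ε
  ... | no  p≮ε = ⊥-elim (ℚ.<-irrefl refl (ℚ.<-≤-trans pp<εε (subst (ε * ε ≤_) (sym (ℚ.∣p*q∣≡∣p∣*∣q∣ p p))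
    (ℚ.≤-trans (ℚ.*-monoˡ-≤-nonNeg ε {{ℚ.pos⇒nonNeg ε {{positive 0<ε}}}} ε≤p)
      (ℚ.*-monoʳ-≤-nonNeg ∣ p ∣ {{ℚ.∣-∣-nonNeg p}} ε≤p)))))
    where
    ε≤p : ε ≤ ∣ p ∣
    ε≤p = ℚ.≮⇒≥ p≮ε

  ℝ-reduced : ∀ x → x *ℝ x ≈ℝ 0ℝ → x ≈ℝ 0ℝ
  ℝ-reduced x eq .near ε 0<ε
    -- Tolerance `ε * ε` for the square is tolerance `ε` for the number itself.
    with near eq (ε * ε) (subst (_< ε * ε) (ℚ.*-zeroʳ ε) (ℚ.*-monoʳ-<-pos ε {{positive 0<ε}} 0<ε))
  ... | N , h = N , λ n n≥ → subst (λ z → ∣ z ∣ < ε) (sym (ℚ.+-identityʳ (seq x n)))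
    (square-<⁻¹ (seq x n) ε 0<ε
      (subst (λ z → ∣ z ∣ < ε * ε) (ℚ.+-identityʳ (seq x n * seq x n)) (h n n≥)))

  ℝ-halve : ∀ x → x +ℝ x ≈ℝ 0ℝ → x ≈ℝ 0ℝ
  ℝ-halve x eq = R.trans (R.sym half) (R.trans (R.*-congˡ eq) (R.zeroʳ (ratℝ ½)))
    where
    half : ratℝ ½ *ℝ (x +ℝ x) ≈ℝ x
    half = RealLemmas.≡⇒≈ λ n → trans (ℚ.*-distribˡ-+ ½ (seq x n) (seq x n)) (RealLemmas.halve (seq x n))

  1≉0ℝ : ¬ 1ℝ ≈ℝ 0ℝ
  1≉0ℝ eq with near eq 1ℚ (ℚ.positive⁻¹ 1ℚ)
  ... | N , h = ℚ.<-irrefl refl (h N ℕ.≤-refl)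

  module _ where
    open IntegerSolver ℝ-commutativeRing
    open import Data.Integer.Base using (0ℤ)

    -- (2x²)² = 4x²(x² - y²) + (2xy)².
    re-vanishes : ∀ x y → x *ℝ x +ℝ -ℝ (y *ℝ y) ≈ℝ 0ℝ → x *ℝ y +ℝ y *ℝ x ≈ℝ 0ℝ → x ≈ℝ 0ℝ
    re-vanishes x y re-eq im-eq = ℝ-reduced x (ℝ-halve (x *ℝ x) (ℝ-reduced (x *ℝ x +ℝ x *ℝ x) (by₂ re-eq im-eq
      (solve 2 (λ x y →
        (x :* x :+ x :* x) :* (x :* x :+ x :* x) :- con 0ℤ :=
        ((x :+ x) :* (x :+ x)) :* ((x :* x :- y :* y) :- con 0ℤ) :+
          (x :* y :+ y :* x) :* ((x :* y :+ y :* x) :- con 0ℤ)) R.refl x y))))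

    -- Once the real part vanishes, the real part of the square is minus the square of the imaginary
    -- part, and the real case applies again.
    ℂ-reduced : ∀ z → z *ℂ z ≈ℂ 0ℂ → z ≈ℂ 0ℂ
    ℂ-reduced z eq = mk≈ℂ x≈0 (ℝ-reduced (im z) (by₂ x≈0 (re≈ eq) (solve 2 (λ x y →
      y :* y :- con 0ℤ := x :* (x :- con 0ℤ) :+ (:- :1) :* ((x :* x :- y :* y) :- con 0ℤ))
      R.refl (re z) (im z))))
      where
      x≈0 : re z ≈ℝ 0ℝ
      x≈0 = re-vanishes (re z) (im z) (re≈ eq) (im≈ eq)

  1≉0ℂ : ¬ 1ℂ ≈ℂ 0ℂ
  1≉0ℂ eq = 1≉0ℝ (re≈ eq)

proposition19 : (a : ℂ) →
    ∃! _≋_ (Construction a) ×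
    (∀ g → Construction a g →
    IsPseudoInvolution g ×
    (∃ λ B → IsBSequence g B ×
    (B ≐ const (2ℂ -ℂ a) ⊕ (1ℂ -ℂ 3ℂ *ℂ a +ℂ a *ℂ a) · X / 1ₛ ⊕ (1ℂ -ℂ a) · X)))
proposition19 a = construction-unique , λ _ → B-function
  where open Elliptic ℂ-commutativeRing a Reducedness.ℂ-reduced Reducedness.1≉0ℂ
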